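{- Let $p$ be a prime, $\nu\in\mathbb{Z}$, $z\in\mathbb{Q}_{p}$. The limit $\mu_p(z,\nu)=\lim_{n\to\infty}F_n(z,\nu)$ is given as follows. (1) If $z$ is a $p$-adic integer, and either $z\ne 0$ and $\mathrm{ord}_{p}(z)<\nu$, or $z=0$ and $\nu\ge 1$, then $$\mu_p(z,\nu)=\frac{1}{p^{\nu}+p^{\nu-1}}.$$ (2) If $z$ is not a $p$-adic integer, $\mathrm{ord}_{p}(z)=-\lambda<0$, and $\mathrm{ord}_p(z)<\nu$, then $$\mu_p(z,\nu)=\frac{1}{p^{\nu+2\lambda}+p^{\nu+2\lambda-1}}.$$ (3) If $z=0$ and $-\nu\le 0$, then $$\mu_p(0,-\nu)=1-\frac{1}{p^{\nu+1}+p^{\nu}}.$$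
   Context: The Calkin–Wilf tree $\mathcal{T}$ is the binary tree with root $\frac{1}{1}$ in which each fraction $\frac{a}{b}$ has the two children $\frac{a}{a+b}$ and $\frac{a+b}{b}$. Its $n$th generation $\mathcal{T}^{(n)}$ ($n\ge 1$, $\mathcal{T}^{(1)}=\{\frac11\}$) consists of $2^{n-1}$ distinct positive rationals. For a prime $p$, $z\in\mathbb{Q}_p$, $\nu\in\mathbb{Z}$, $$F_{n}(z,\nu)=2^{ -n+1}\,\#\left\{\tfrac{a}{b}\in\mathcal{T}^{(n)}:\ \mathrm{ord}_{p}\left(\tfrac{a}{b}-z\right)\ge\nu\right\},$$ where $\mathrm{ord}_p$ is the $p$-adic valuation, $\mathrm{ord}_p(0)=+\infty$. -}

module Defs where

open import Data.Empty using (⊥-elim)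
open import Data.Integer as ℤ using (ℤ; +_; -[1+_])
import Data.Integer.Divisibility.Signed as ℤ∣
import Data.Integer.Properties as ℤ
open import Data.List using (List; []; _∷_; map; filter; length; concatMap)
open import Data.List.Relation.Unary.All using (All; []; _∷_)
open import Data.List.Relation.Unary.AllPairs as AllPairs using (AllPairs; []; _∷_)
import Data.List.Relation.Unary.AllPairs.Properties as AllPairs
open import Data.List.Relation.Unary.Unique.Propositional using (Unique)
open import Data.Maybe as Maybe using ()
open import Data.Nat as ℕ using (ℕ; zero; suc; NonZero; NonTrivial)
open import Data.Nat.Divisibility using (_∣_; _∣?_; divides; ∣-trans; *-cancelˡ-∣; m∣m*n; *-monoʳ-∣; 1∣_)
open import Data.Nat.Primality using (Prime; euclidsLemma; prime⇒nonTrivial; prime⇒nonZero)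
import Data.Nat.Properties as ℕ
import Data.Nat.Solver as ℕ
open import Data.Product using (∃; _×_; _,_; proj₁; proj₂)
open import Data.Rational as ℚ using (ℚ; mkℚ; 0ℚ; ↥_; ↧_; ↧ₙ_)
import Data.Rational.Properties as ℚ
import Data.Rational.Solver as ℚ
open import Data.Rational.Unnormalised as ℚᵘ using (mkℚᵘ)
open import Data.Sum using (inj₁; inj₂)
open import Relation.Binary.PropositionalEquality using (_≡_; _≢_; refl; sym; trans; cong; cong₂; subst; subst₂)
open import Relation.Nullary using (¬_; Dec; yes; no)
open import Relation.Nullary.Construct.Add.Supremum using (_⁺; [_]; ⊤⁺)
open import Relation.Binary.Construct.Add.Supremum.NonStrict ℤ._≤_ using (_≤⁺_; [_]; _≤⊤⁺; ≤⁺-dec)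

-- The fuel f only ensures termination; f = n is enough because the
-- quotient n / p is smaller than n (see ordℕ-spec).

ordFuel : (p f n : ℕ) → ℕ
ordFuel p zero    n = 0
ordFuel p (suc f) n with p ∣? n
... | yes (divides q _) = suc (ordFuel p f q)
... | no  _             = 0

-- The junk value ordℕ p 0 = 0 is never used by ordℤ and ord.

ordℕ : (p n : ℕ) → ℕ
ordℕ p n = ordFuel p n n

ℤ∞ : Set
ℤ∞ = ℤ ⁺

ordℤ : ℕ → ℤ → ℤ∞
ordℤ p i with ℤ.∣ i ∣
... | zero      = ⊤⁺
... | n@(suc _) = [ + ordℕ p n ]

ord : ℕ → ℚ → ℤ∞
ord p q = Maybe.map (ℤ._- + ordℕ p (↧ₙ q)) (ordℤ p (↥ q))

ordFuel-spec : ∀ p .⦃ _ : NonTrivial p ⦄ f n .⦃ _ : NonZero n ⦄ → n ℕ.≤ f →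
               ∃ λ c → n ≡ p ℕ.^ ordFuel p f n ℕ.* c × ¬ (p ∣ c)
ordFuel-spec p zero    (suc n) ()
ordFuel-spec p (suc f) n n≤f with p ∣? n
... | no  p∤n              = n , sym (ℕ.+-identityʳ n) , p∤n
... | yes (divides q refl) with ordFuel-spec p f q ⦃ ℕ.m*n≢0⇒m≢0 q ⦄
                                  (ℕ.≤-pred (ℕ.≤-trans (ℕ.m<m*n q p ⦃ ℕ.m*n≢0⇒m≢0 q ⦄ (ℕ.nonTrivial⇒n>1 p)) n≤f))
...   | c , q≡ , p∤c = c , trans (cong (ℕ._* p) q≡) (lemma p (p ℕ.^ ordFuel p f q) c) , p∤c
  where
  open ℕ.+-*-Solver
  lemma : ∀ p e c → e ℕ.* c ℕ.* p ≡ p ℕ.* e ℕ.* c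
  lemma = solve 3 (λ p e c → e :* c :* p := p :* e :* c) refl

ordℕ-spec : ∀ p .⦃ _ : NonTrivial p ⦄ n .⦃ _ : NonZero n ⦄ →
            ∃ λ c → n ≡ p ℕ.^ ordℕ p n ℕ.* c × ¬ (p ∣ c)
ordℕ-spec p n = ordFuel-spec p n n ℕ.≤-refl

∤-bound : ∀ p .⦃ _ : NonTrivial p ⦄ k v {c} → ¬ (p ∣ c) → p ℕ.^ k ∣ p ℕ.^ v ℕ.* c → k ℕ.≤ v
∤-bound p zero    v       p∤c d = ℕ.z≤n
∤-bound p (suc k) zero    {c} p∤c d =
  ⊥-elim (p∤c (∣-trans (m∣m*n (p ℕ.^ k)) (subst (p ℕ.^ suc k ∣_) (ℕ.+-identityʳ c) d)))
∤-bound p (suc k) (suc v) {c} p∤c d = ℕ.s≤s (∤-bound p k v p∤c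
  (*-cancelˡ-∣ p ⦃ ℕ.nonTrivial⇒nonZero p ⦄ (subst (p ℕ.^ suc k ∣_) (ℕ.*-assoc p (p ℕ.^ v) c) d)))

^-∣ : ∀ p {k v} → k ℕ.≤ v → p ℕ.^ k ∣ p ℕ.^ v
^-∣ p ℕ.z≤n       = 1∣ _
^-∣ p (ℕ.s≤s k≤v) = *-monoʳ-∣ p (^-∣ p k≤v)

^∣⇒≤ordℕ : ∀ p .⦃ _ : NonTrivial p ⦄ k n .⦃ _ : NonZero n ⦄ → p ℕ.^ k ∣ n → k ℕ.≤ ordℕ p n
^∣⇒≤ordℕ p k n d with ordℕ-spec p n
... | c , n≡ , p∤c = ∤-bound p k (ordℕ p n) p∤c (subst (p ℕ.^ k ∣_) n≡ d)

≤ordℕ⇒^∣ : ∀ p .⦃ _ : NonTrivial p ⦄ k n .⦃ _ : NonZero n ⦄ → k ℕ.≤ ordℕ p n → p ℕ.^ k ∣ n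
≤ordℕ⇒^∣ p k n le with ordℕ-spec p n
... | c , n≡ , _ = subst (p ℕ.^ k ∣_) (sym n≡) (∣-trans (^-∣ p le) (m∣m*n c))

ordℕ-unique : ∀ p .⦃ _ : NonTrivial p ⦄ v {n c} .⦃ _ : NonZero n ⦄ →
              n ≡ p ℕ.^ v ℕ.* c → ¬ (p ∣ c) → ordℕ p n ≡ v
ordℕ-unique p v {n} {c} n≡ p∤c = ℕ.≤-antisym
  (∤-bound p (ordℕ p n) v p∤c (subst (p ℕ.^ ordℕ p n ∣_) n≡ (≤ordℕ⇒^∣ p _ n ℕ.≤-refl)))
  (^∣⇒≤ordℕ p v n (subst (p ℕ.^ v ∣_) (sym n≡) (m∣m*n c)))

ordℕ-* : ∀ p ⦃ _ : Prime p ⦄ m n .⦃ _ : NonZero m ⦄ .⦃ _ : NonZero n ⦄ →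
         ordℕ p (m ℕ.* n) ≡ ordℕ p m ℕ.+ ordℕ p n
ordℕ-* p ⦃ pr ⦄ m n with ordℕ-spec p ⦃ prime⇒nonTrivial pr ⦄ m | ordℕ-spec p ⦃ prime⇒nonTrivial pr ⦄ n
... | c , m≡ , p∤c | d , n≡ , p∤d =
  ordℕ-unique p ⦃ prime⇒nonTrivial pr ⦄ (a ℕ.+ b) ⦃ ℕ.m*n≢0 m n ⦄ m*n≡ p∤cd
  where
  open ℕ.+-*-Solver
  a b : ℕ
  a = ordℕ p m
  b = ordℕ p n
  lemma : ∀ x y c d → x ℕ.* c ℕ.* (y ℕ.* d) ≡ x ℕ.* y ℕ.* (c ℕ.* d)
  lemma = solve 4 (λ x y c d → x :* c :* (y :* d) := x :* y :* (c :* d)) refl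
  m*n≡ : m ℕ.* n ≡ p ℕ.^ (a ℕ.+ b) ℕ.* (c ℕ.* d)
  m*n≡ = trans (cong₂ ℕ._*_ m≡ n≡)
        (trans (lemma (p ℕ.^ a) (p ℕ.^ b) c d)
               (cong (ℕ._* (c ℕ.* d)) (sym (ℕ.^-distribˡ-+-* p a b))))
  p∤cd : ¬ (p ∣ c ℕ.* d)
  p∤cd h with euclidsLemma c d pr h
  ... | inj₁ p∣c = p∤c p∣c
  ... | inj₂ p∣d = p∤d p∣d

^∣⇒≤ordℤ : ∀ p ⦃ _ : Prime p ⦄ k i → p ℕ.^ k ∣ ℤ.∣ i ∣ → [ + k ] ≤⁺ ordℤ p i
^∣⇒≤ordℤ p ⦃ pr ⦄ k i d with ℤ.∣ i ∣
... | zero      = _ ≤⊤⁺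
... | n@(suc _) = [ ℤ.+≤+ (^∣⇒≤ordℕ p ⦃ prime⇒nonTrivial pr ⦄ k n d) ]

≤ordℤ⇒^∣ : ∀ p ⦃ _ : Prime p ⦄ k i → [ + k ] ≤⁺ ordℤ p i → p ℕ.^ k ∣ ℤ.∣ i ∣
≤ordℤ⇒^∣ p ⦃ pr ⦄ k i le with ℤ.∣ i ∣ | le
... | zero      | _              = divides 0 refl
... | n@(suc _) | [ ℤ.+≤+ k≤v ] = ≤ordℕ⇒^∣ p ⦃ prime⇒nonTrivial pr ⦄ k n k≤v

ordℤ-+ : ∀ p ⦃ _ : Prime p ⦄ k i j → [ k ] ≤⁺ ordℤ p i → [ k ] ≤⁺ ordℤ p j → [ k ] ≤⁺ ordℤ p (i ℤ.+ j)
ordℤ-+ p (+ k) i j ki kj = ^∣⇒≤ordℤ p k (i ℤ.+ j)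
  (ℤ∣.∣⇒∣ᵤ {+ (p ℕ.^ k)} {i ℤ.+ j} (ℤ∣.∣m∣n⇒∣m+n {+ (p ℕ.^ k)} {i} {j}
    (ℤ∣.∣ᵤ⇒∣ (≤ordℤ⇒^∣ p k i ki)) (ℤ∣.∣ᵤ⇒∣ (≤ordℤ⇒^∣ p k j kj))))
ordℤ-+ p -[1+ k ] i j _ _ with ℤ.∣ i ℤ.+ j ∣
... | zero  = _ ≤⊤⁺
... | suc _ = [ ℤ.-≤+ ]

ordℤ-* : ∀ p ⦃ _ : Prime p ⦄ i n .⦃ _ : NonZero n ⦄ →
         ordℤ p (i ℤ.* + n) ≡ Maybe.map (ℤ._+ + ordℕ p n) (ordℤ p i)
ordℤ-* p i n with ℤ.∣ i ∣ | ℤ.∣ i ℤ.* + n ∣ | ℤ.abs-* i (+ n)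
... | zero      | .0             | refl = refl
... | m@(suc _) | zero           | eq   =
  ⊥-elim (ℕ.≢-nonZero⁻¹ (m ℕ.* n) ⦃ ℕ.m*n≢0 m n ⦄ (sym eq))
... | m@(suc _) | k@(suc _)      | eq   =
  cong [_] (cong +_ (trans (cong (ordℕ p) eq) (ordℕ-* p m n)))

ord-/ : ∀ p ⦃ _ : Prime p ⦄ a d .⦃ _ : NonZero d ⦄ q → ↥ q ℤ.* + d ≡ a ℤ.* ↧ q →
        ordℤ p a ≡ Maybe.map (ℤ._+ + ordℕ p d) (ord p q)
ord-/ p a d q@record{} eq
  with ordℤ p (↥ q) | ordℤ p a
     | trans (sym (ordℤ-* p (↥ q) d)) (trans (cong (ordℤ p) eq) (ordℤ-* p a (↧ₙ q)))
... | ⊤⁺    | ⊤⁺    | _ = refl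
... | [ x ] | [ y ] | h = cong [_] (arith x y (+ ordℕ p d) (+ ordℕ p (↧ₙ q)) (Maybe-inj h))
  where
  open import Data.Integer.Solver using (module +-*-Solver)
  open +-*-Solver
  Maybe-inj : ∀ {x y : ℤ} → [ x ] ≡ [ y ] → x ≡ y
  Maybe-inj refl = refl
  arith : ∀ x y u v → x ℤ.+ u ≡ y ℤ.+ v → y ≡ x ℤ.- v ℤ.+ u
  arith x y u v h = trans (solve 2 (λ y v → y := y :+ v :- v) refl y v)
    (trans (cong (ℤ._- v) (sym h)) (solve 3 (λ x u v → x :+ u :- v := x :- v :+ u) refl x u v))

≤-map-+ : ∀ {k x} u → [ k ] ≤⁺ x → [ k ℤ.+ u ] ≤⁺ Maybe.map (ℤ._+ u) x
≤-map-+ u [ le ]    = [ ℤ.+-monoˡ-≤ u le ]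
≤-map-+ u (_ ≤⊤⁺) = _ ≤⊤⁺

≤-map-+⁻¹ : ∀ {k x} u → [ k ℤ.+ u ] ≤⁺ Maybe.map (ℤ._+ u) x → [ k ] ≤⁺ x
≤-map-+⁻¹ {k} {[ x ]} u [ le ] = [ subst₂ ℤ._≤_ (cancel k) (cancel x) (ℤ.+-monoˡ-≤ (ℤ.- u) le) ]
  where
  cancel : ∀ x → x ℤ.+ u ℤ.- u ≡ x
  cancel x = trans (ℤ.+-assoc x u (ℤ.- u)) (trans (cong (ℤ._+_ x) (ℤ.+-inverseʳ u)) (ℤ.+-identityʳ x))
≤-map-+⁻¹ {k} {⊤⁺}    u _      = _ ≤⊤⁺

ord-+ : ∀ p ⦃ _ : Prime p ⦄ k x y → [ k ] ≤⁺ ord p x → [ k ] ≤⁺ ord p y → [ k ] ≤⁺ ord p (x ℚ.+ y)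
ord-+ p k x@record{} y@record{} kx ky =
  ≤-map-+⁻¹ u (subst ([ k ℤ.+ u ] ≤⁺_) (ord-/ p (A ℤ.+ B) d (x ℚ.+ y) sum≡)
    (ordℤ-+ p (k ℤ.+ u) A B
      (subst ([ k ℤ.+ u ] ≤⁺_) (sym (ord-/ p A d x (lemma (↥ x) (↧ x) (↧ y)))) (≤-map-+ u kx))
      (subst ([ k ℤ.+ u ] ≤⁺_) (sym (ord-/ p B d y (lemma′ (↥ y) (↧ x) (↧ y)))) (≤-map-+ u ky))))
  where
  open import Data.Integer.Solver using (module +-*-Solver)
  open +-*-Solver
  A B u : ℤ
  A = ↥ x ℤ.* ↧ y
  B = ↥ y ℤ.* ↧ x
  d : ℕ
  d = ↧ₙ x ℕ.* ↧ₙ y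
  u = + ordℕ p d
  lemma : ∀ a b c → a ℤ.* (b ℤ.* c) ≡ a ℤ.* c ℤ.* b
  lemma = solve 3 (λ a b c → a :* (b :* c) := a :* c :* b) refl
  lemma′ : ∀ a b c → a ℤ.* (b ℤ.* c) ≡ a ℤ.* b ℤ.* c
  lemma′ = solve 3 (λ a b c → a :* (b :* c) := a :* b :* c) refl
  sum≡ : ↥ (x ℚ.+ y) ℤ.* + d ≡ (A ℤ.+ B) ℤ.* ↧ (x ℚ.+ y)
  sum≡ with ℚᵘ.*≡* h ← ℚ.toℚᵘ-homo-+ x y = trans
    (cong (ℤ._* + d) (sym (ℚ.↥ᵘ-toℚᵘ (x ℚ.+ y))))
    (trans h (cong ((A ℤ.+ B) ℤ.*_) (ℚ.↧ᵘ-toℚᵘ (x ℚ.+ y))))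

ord-neg : ∀ p x → ord p (ℚ.- x) ≡ ord p x
ord-neg p (mkℚ (+ zero)    _ _) = refl
ord-neg p (mkℚ (+ (suc _)) _ _) = refl
ord-neg p (mkℚ -[1+ _ ]    _ _) = refl

Eventually : (ℕ → Set) → Set
Eventually P = ∃ λ N → ∀ n → N ℕ.≤ n → P n

-- ℚₚ is the completion of ℚ: Cauchy sequences for the p-adic absolute
-- value, considered up to _≈_ below.

record ℚₚ (p : ℕ) : Set where
  field
    seq    : ℕ → ℚ
    cauchy : ∀ (k : ℤ) → ∃ λ N → ∀ m n → N ℕ.≤ m → N ℕ.≤ n →
             [ k ] ≤⁺ ord p (seq m ℚ.- seq n)

open ℚₚ public

ι : ∀ {p} → ℚ → ℚₚ p
ι {p} q = record
  { seq    = λ _ → q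
  ; cauchy = λ k → 0 , λ _ _ _ _ → subst (λ x → [ k ] ≤⁺ ord p x) (sym (ℚ.+-inverseʳ q)) (_ ≤⊤⁺)
  }

0ₚ : ∀ {p} → ℚₚ p
0ₚ = ι 0ℚ

infixl 6 _-ₚ_

_-ₚ_ : ∀ {p} ⦃ _ : Prime p ⦄ → ℚₚ p → ℚₚ p → ℚₚ p
_-ₚ_ {p} x y = record
  { seq    = λ n → seq x n ℚ.- seq y n
  ; cauchy = λ k → proj₁ (cauchy x k) ℕ.⊔ proj₁ (cauchy y k) , λ m n m≥ n≥ →
      subst (λ q → [ k ] ≤⁺ ord p q)
        (lemma (seq x m) (seq x n) (seq y m) (seq y n))
        (ord-+ p k (seq x m ℚ.- seq x n) (ℚ.- (seq y m ℚ.- seq y n))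
          (proj₂ (cauchy x k) m n (ℕ.m⊔n≤o⇒m≤o _ _ m≥) (ℕ.m⊔n≤o⇒m≤o _ _ n≥))
          (subst ([ k ] ≤⁺_) (sym (ord-neg p (seq y m ℚ.- seq y n)))
            (proj₂ (cauchy y k) m n (ℕ.m⊔n≤o⇒n≤o _ _ m≥) (ℕ.m⊔n≤o⇒n≤o _ _ n≥))))
  }
  where
  open ℚ.+-*-Solver
  lemma : ∀ a b c d → (a ℚ.- b) ℚ.+ (ℚ.- (c ℚ.- d)) ≡ (a ℚ.- c) ℚ.- (b ℚ.- d)
  lemma = solve 4 (λ a b c d → (a :- b) :+ (:- (c :- d)) := (a :- c) :- (b :- d)) refl

-- ord extends from ℚ to ℚₚ by continuity: ord(z) is the limit of
-- ord(seq z n) in ℤ ∪ {∞}.  This limit cannot be computed as an element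
-- of ℤ∞ (that would decide z ≈ 0ₚ), so ord(z) enters through the
-- relations ord(z) ≥ ν, ord(z) < ν and ord(z) = v.

infix 4 ordₚ_≥_ ordₚ_<_ ordₚ_≡_ ordₚ_≥?_ _≈_ _≉_

ordₚ_≥_ : ∀ {p} → ℚₚ p → ℤ → Set
ordₚ_≥_ {p} z ν = Eventually λ n → [ ν ] ≤⁺ ord p (seq z n)

ordₚ_<_ : ∀ {p} → ℚₚ p → ℤ → Set
ordₚ z < ν = ¬ (ordₚ z ≥ ν)

ordₚ_≡_ : ∀ {p} → ℚₚ p → ℤ → Set
ordₚ_≡_ {p} z v = Eventually λ n → ord p (seq z n) ≡ [ v ]

_≈_ : ∀ {p} ⦃ _ : Prime p ⦄ → ℚₚ p → ℚₚ p → Set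
x ≈ y = ∀ k → ordₚ (x -ₚ y) ≥ k

_≉_ : ∀ {p} ⦃ _ : Prime p ⦄ → ℚₚ p → ℚₚ p → Set
x ≉ y = ¬ (x ≈ y)

IsInteger : ∀ {p} → ℚₚ p → Set
IsInteger z = ordₚ z ≥ ℤ.0ℤ

ord-transfer : ∀ p ⦃ _ : Prime p ⦄ k x y → [ k ] ≤⁺ ord p x → [ k ] ≤⁺ ord p (y ℚ.- x) → [ k ] ≤⁺ ord p y
ord-transfer p k x y h d = subst (λ q → [ k ] ≤⁺ ord p q)
  (solve 2 (λ a b → (a :- b) :+ b := a) refl y x) (ord-+ p k (y ℚ.- x) x d h)
  where open ℚ.+-*-Solver

ordₚ_≥?_ : ∀ {p} ⦃ _ : Prime p ⦄ (z : ℚₚ p) (ν : ℤ) → Dec (ordₚ z ≥ ν)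
ordₚ_≥?_ {p} z ν with cauchy z ν
... | N , close with ≤⁺-dec ℤ._≤?_ [ ν ] (ord p (seq z N))
...   | yes le = yes (N , λ n N≤n →
                   ord-transfer p ν (seq z N) (seq z n) le (close n N N≤n ℕ.≤-refl))
...   | no ¬le = no λ (M , h) → ¬le
                   (ord-transfer p ν (seq z (M ℕ.⊔ N)) (seq z N) (h _ (ℕ.m≤m⊔n M N))
                     (close N _ ℕ.≤-refl (ℕ.m≤n⊔m M N)))

record Fraction : Set where
  constructor _/_
  field
    num           : ℕ
    den           : ℕ
    .⦃ den≢0 ⦄ : NonZero den

open Fraction public

value : Fraction → ℚ
value (a / b) = + a ℚ./ b

+-nonZeroʳ : ∀ a b .⦃ _ : NonZero b ⦄ → NonZero (a ℕ.+ b)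
+-nonZeroʳ zero    b = ℕ.≢-nonZero (ℕ.≢-nonZero⁻¹ b)
+-nonZeroʳ (suc a) b = _

left right : Fraction → Fraction
left  (a / b) = _/_ a (a ℕ.+ b) ⦃ +-nonZeroʳ a b ⦄
right (a / b) = (a ℕ.+ b) / b

children : Fraction → List Fraction
children x = left x ∷ right x ∷ []

-- Generations are numbered from 1; generation 0 is empty.

generation : ℕ → List Fraction
generation 0             = []
generation 1             = (1 / 1) ∷ []
generation (suc (suc n)) = concatMap children (generation (suc n))

𝒯 : ℕ → List ℚ
𝒯 n = map value (generation n)

-- Distinctness as rational numbers, by cross-multiplication.

_#_ : Fraction → Fraction → Set
x # y = num x ℕ.* den y ≢ num y ℕ.* den x

left-# : ∀ {x y} → x # y → left x # left y
left-# {a / b} {c / d} x#y eq = x#y (ℕ.+-cancelˡ-≡ (a ℕ.* c) _ _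
  (trans (sym (ℕ.*-distribˡ-+ a c d)) (trans eq (trans (ℕ.*-distribˡ-+ c a b) (cong (ℕ._+ c ℕ.* b) (ℕ.*-comm c a))))))

right-# : ∀ {x y} → x # y → right x # right y
right-# {a / b} {c / d} x#y eq = x#y (ℕ.+-cancelʳ-≡ (b ℕ.* d) _ _
  (trans (sym (ℕ.*-distribʳ-+ d a b)) (trans eq (trans (ℕ.*-distribʳ-+ b c d) (cong (c ℕ.* b ℕ.+_) (ℕ.*-comm d b))))))

left-#-right : ∀ x y → left x # right y
left-#-right (a / b) (c / d) eq = ℕ.<-irrefl eq (begin-strict
  a ℕ.* d                   <⟨ ℕ.*-monoˡ-< d (ℕ.m<m+n a (ℕ.n≢0⇒n>0 (ℕ.≢-nonZero⁻¹ b))) ⟩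
  (a ℕ.+ b) ℕ.* d           ≡⟨ ℕ.*-comm (a ℕ.+ b) d ⟩
  d ℕ.* (a ℕ.+ b)           ≤⟨ ℕ.*-monoˡ-≤ (a ℕ.+ b) (ℕ.m≤n+m d c) ⟩
  (c ℕ.+ d) ℕ.* (a ℕ.+ b)   ∎)
  where open ℕ.≤-Reasoning

children-# : ∀ {xs} → AllPairs _#_ xs → AllPairs _#_ (concatMap children xs)
children-# []                    = []
children-# {x ∷ xs} (x# ∷ xs#) =
  (left-#-right x x ∷ lefts x#) ∷ rights x# ∷ children-# xs#
  where
  lefts : ∀ {ys} → All (x #_) ys → All (left x #_) (concatMap children ys)
  lefts []                = []
  lefts {y ∷ _} (h ∷ hs) = left-# {x} {y} h ∷ left-#-right x y ∷ lefts hs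
  rights : ∀ {ys} → All (x #_) ys → All (right x #_) (concatMap children ys)
  rights []                = []
  rights {y ∷ _} (h ∷ hs) = (λ eq → left-#-right y x (sym eq)) ∷ right-# {x} {y} h ∷ rights hs

generation-# : ∀ n → AllPairs _#_ (generation n)
generation-# 0             = []
generation-# 1             = [] ∷ []
generation-# (suc (suc n)) = children-# (generation-# (suc n))

#⇒≢ : ∀ {x y} → x # y → value x ≢ value y
#⇒≢ {a / suc b} {c / suc d} x#y eq
  with ℚᵘ.*≡* h ← ℚ./-injective-≃ (mkℚᵘ (+ a) b) (mkℚᵘ (+ c) d) eq =
  x#y (ℤ.+-injective (trans (ℤ.pos-* a (suc d)) (trans h (sym (ℤ.pos-* c (suc b))))))

-- Hence the length of a filtered sublist of 𝒯 n, as in F below, is the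
-- cardinality of the corresponding set of rationals.

𝒯-unique : ∀ n → Unique (𝒯 n)
𝒯-unique n = AllPairs.map⁺ (AllPairs.map (λ {x} {y} → #⇒≢ {x} {y}) (generation-# n))

infixr 8 _^_

_^_ : (b : ℕ) .⦃ _ : NonZero b ⦄ → ℤ → ℚ
b ^ (+ k)    = + (b ℕ.^ k) ℚ./ 1
b ^ -[1+ k ] = (+ 1 ℚ./ (b ℕ.^ suc k)) ⦃ ℕ.m^n≢0 b (suc k) ⦄

^-positive : ∀ b .⦃ _ : NonZero b ⦄ k → ℚ.Positive (b ^ k)
^-positive b (+ k)    = ℚ.normalize-pos (b ℕ.^ k) 1 ⦃ _ ⦄ ⦃ ℕ.m^n≢0 b k ⦄
^-positive b -[1+ k ] = ℚ.normalize-pos 1 (b ℕ.^ suc k) ⦃ ℕ.m^n≢0 b (suc k) ⦄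

1/[_^_+^_] : (p : ℕ) ⦃ _ : Prime p ⦄ → ℤ → ℤ → ℚ
1/[_^_+^_] p ⦃ pr ⦄ j k = (ℚ.1/ (p ^ j ℚ.+ p ^ k)) ⦃ sum≢0 ⦄
  where
  instance
    p≢0 : NonZero p
    p≢0 = prime⇒nonZero pr
  sum≢0 : ℚ.NonZero (p ^ j ℚ.+ p ^ k)
  sum≢0 = ℚ.pos⇒nonZero (p ^ j ℚ.+ p ^ k)
    ⦃ ℚ.pos+pos⇒pos (p ^ j) ⦃ ^-positive p j ⦄ (p ^ k) ⦃ ^-positive p k ⦄ ⦄

F : ∀ {p} ⦃ _ : Prime p ⦄ → ℚₚ p → ℤ → ℕ → ℚ
F z ν n = 2 ^ (ℤ.- + n ℤ.+ ℤ.1ℤ) ℚ.* (+ length (filter (λ q → ordₚ ι q -ₚ z ≥? ν) (𝒯 n)) ℚ./ 1)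

infix 4 _⟶_

_⟶_ : (ℕ → ℚ) → ℚ → Set
u ⟶ l = ∀ ε → 0ℚ ℚ.< ε → Eventually λ n → ℚ.∣ u n ℚ.- l ∣ ℚ.< ε

{-# OPTIONS --safe #-}
module Submission where

-- Sending a fraction to one of its two children acts on pairs (a , b) modulo M = p ^ (κ + 1) by a
-- permutation of the primitive ones, those with a or b prime to p. From each of them (1 , 0) is
-- reached in a fixed number N of steps, so of the 2 ^ N descents from each of two primitive pairs
-- one ends at this common point, and the oscillation of the proportions over primitive pairs shrinks
-- by a factor 1 - 2 ^ -N every N generations, while their average does not change.
-- So each point of the projective line over ℤ / M receives the asymptotic share
-- 1 / (p ^ (κ + 1) + p ^ κ).
-- If z is approximated by u / w in lowest terms, with λ = ord w and ν > - λ, then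
-- ord (a / b - u / w) ≥ ν says that (a : b) is the point a w = u b modulo p ^ (ν + 2 λ); this covers
-- (1), where λ = 0, and (2). In (3), ord (a / b) ≥ - ν fails exactly at the point b = 0 modulo
-- p ^ (ν + 1).

-- Finite sums over residues, and indicator functions.

module Sums where
  open import Data.Fin using (zero; suc; toℕ)
  open import Data.Nat
  open import Data.Nat.Divisibility using (_∣_; _∣?_; ∣m+n∣m⇒∣n; ∣m∣n⇒∣m+n; ∣-refl; >⇒∤; _∣0)
  open import Data.Nat.Properties
  open import Data.Nat.Solver using (module +-*-Solver)
  open import Function using (_∘_)
  open import Relation.Binary.PropositionalEquality
  open import Relation.Nullary using (Dec; yes; no; contradiction; ¬?; _×-dec_)

  import Algebra.Properties.Semiring.Sum +-*-semiring as Σ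

  ∑ : ℕ → (ℕ → ℕ) → ℕ
  ∑ n f = Σ.sum {n} (f ∘ toℕ)

  ∑-cong : ∀ n {f g} → (∀ i → f i ≡ g i) → ∑ n f ≡ ∑ n g
  ∑-cong n f≗g = Σ.sum-cong-≗ {n} (f≗g ∘ toℕ)

  ∑-+ : ∀ n f g → ∑ n (λ i → f i + g i) ≡ ∑ n f + ∑ n g
  ∑-+ n f g = Σ.∑-distrib-+ {n} (f ∘ toℕ) (g ∘ toℕ)

  ∑-comm : ∀ m n (f : ℕ → ℕ → ℕ) → ∑ m (λ i → ∑ n (f i)) ≡ ∑ n (λ j → ∑ m (λ i → f i j))
  ∑-comm m n f = Σ.∑-comm {m} {n} (λ i j → f (toℕ i) (toℕ j))

  ∑-*ˡ : ∀ n c f → ∑ n (λ i → c * f i) ≡ c * ∑ n f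
  ∑-*ˡ n c f = sym (Σ.*-distribˡ-sum {n} c (f ∘ toℕ))

  ∑-const : ∀ n c → ∑ n (λ _ → c) ≡ n * c
  ∑-const zero    c = refl
  ∑-const (suc n) c = cong (c +_) (∑-const n c)

  ∑-mono : ∀ n {f g} → (∀ i → f i ≤ g i) → ∑ n f ≤ ∑ n g
  ∑-mono zero    f≤g = z≤n
  ∑-mono (suc n) f≤g = +-mono-≤ (f≤g 0) (∑-mono n (f≤g ∘ suc))

  ∑-append : ∀ m n f → ∑ (m + n) f ≡ ∑ m f + ∑ n (f ∘ (m +_))
  ∑-append zero    n f = refl
  ∑-append (suc m) n f = trans (cong (f 0 +_) (∑-append m n (f ∘ suc))) (sym (+-assoc (f 0) _ _))

  ∑-suc : ∀ n f → f n ≡ f 0 → ∑ n (f ∘ suc) ≡ ∑ n f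
  ∑-suc n f fn≡f0 = +-cancelˡ-≡ (f 0) _ _ (begin
    ∑ (suc n) f             ≡⟨ cong (λ k → ∑ k f) (+-comm 1 n) ⟩
    ∑ (n + 1) f             ≡⟨ ∑-append n 1 f ⟩
    ∑ n f + (f (n + 0) + 0) ≡⟨ cong (∑ n f +_) (trans (+-identityʳ _) (trans (cong f (+-identityʳ n)) fn≡f0)) ⟩
    ∑ n f + f 0             ≡⟨ +-comm _ (f 0) ⟩
    f 0 + ∑ n f             ∎)
    where open ≡-Reasoning

  Periodic : ℕ → (ℕ → ℕ) → Set
  Periodic n f = ∀ i → f (n + i) ≡ f i

  ∑-shift : ∀ {n f} → Periodic n f → ∀ s → ∑ n (λ i → f (s + i)) ≡ ∑ n f
  ∑-shift         per zero    = refl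
  ∑-shift {n} {f} per (suc s) = trans (∑-shift {n} {f ∘ suc} per′ s)
    (∑-suc n f (trans (cong f (sym (+-identityʳ n))) (per 0)))
    where
    per′ : Periodic n (f ∘ suc)
    per′ i = trans (cong f (sym (+-suc n i))) (per (suc i))

  ∑-periods : ∀ {n f} → Periodic n f → ∀ k → ∑ (k * n) f ≡ k * ∑ n f
  ∑-periods         per zero    = refl
  ∑-periods {n} {f} per (suc k) = trans (∑-append n (k * n) f)
    (cong (∑ n f +_) (trans (∑-cong (k * n) per) (∑-periods per k)))

  𝟙 : ∀ {A : Set} → Dec A → ℕ
  𝟙 (yes _) = 1
  𝟙 (no _)  = 0

  𝟙≤1 : ∀ {A} (d : Dec A) → 𝟙 d ≤ 1
  𝟙≤1 (yes _) = ≤-refl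
  𝟙≤1 (no _)  = z≤n

  𝟙-cong : ∀ {A B} (d : Dec A) (e : Dec B) → (A → B) → (B → A) → 𝟙 d ≡ 𝟙 e
  𝟙-cong (yes a) (yes b) f g = refl
  𝟙-cong (yes a) (no ¬b) f g = contradiction (f a) ¬b
  𝟙-cong (no ¬a) (yes b) f g = contradiction (g b) ¬a
  𝟙-cong (no ¬a) (no ¬b) f g = refl

  𝟙-× : ∀ {A B} (d : Dec A) (e : Dec B) → 𝟙 (d ×-dec e) ≡ 𝟙 d * 𝟙 e
  𝟙-× (yes _) (yes _) = refl
  𝟙-× (yes _) (no _)  = refl
  𝟙-× (no _)  (yes _) = refl
  𝟙-× (no _)  (no _)  = refl

  𝟙-¬ : ∀ {A} (d : Dec A) → 𝟙 (¬? d) + 𝟙 d ≡ 1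
  𝟙-¬ (yes _) = refl
  𝟙-¬ (no _)  = refl

  ∣?-periodic : ∀ n c → Periodic n (λ i → 𝟙 (n ∣? c + i))
  ∣?-periodic n c i = 𝟙-cong _ _ (λ d → ∣m+n∣m⇒∣n (subst (n ∣_) eq d) ∣-refl)
                                 (λ d → subst (n ∣_) (sym eq) (∣m∣n⇒∣m+n ∣-refl d))
    where
    open +-*-Solver
    eq : c + (n + i) ≡ n + (c + i)
    eq = solve 3 (λ c n i → c :+ (n :+ i) := n :+ (c :+ i)) refl c n i

  -- By periodicity the n consecutive integers may be taken to start at 0, and of 0 , ... , n - 1
  -- only 0 is a multiple of n.
  ∑-∣? : ∀ n .⦃ _ : NonZero n ⦄ c → ∑ n (λ i → 𝟙 (n ∣? c + i)) ≡ 1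
  ∑-∣? n@(suc m) c = trans (∑-shift {n} (∣?-periodic n 0) c) (cong₂ _+_ head≡1 (tail≡0 m ≤-refl))
    where
    head≡1 : 𝟙 (n ∣? 0) ≡ 1
    head≡1 with n ∣? 0
    ... | yes _ = refl
    ... | no ¬d = contradiction (n ∣0) ¬d
    term≡0 : ∀ i → i < m → 𝟙 (n ∣? suc i) ≡ 0
    term≡0 i i<m with n ∣? suc i
    ... | yes d = contradiction d (>⇒∤ (s≤s i<m))
    ... | no _  = refl
    tail≡0 : ∀ k → k ≤ m → ∑ k (λ i → 𝟙 (n ∣? suc i)) ≡ 0
    tail≡0 zero    _   = refl
    tail≡0 (suc k) k<m = begin
      ∑ (suc k) f             ≡⟨ cong (λ l → ∑ l f) (+-comm 1 k) ⟩
      ∑ (k + 1) f             ≡⟨ ∑-append k 1 f ⟩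
      ∑ k f + (f (k + 0) + 0) ≡⟨ cong₂ _+_ (tail≡0 k (<⇒≤ k<m)) (trans (+-identityʳ _) (trans (cong f (+-identityʳ k)) (term≡0 k k<m))) ⟩
      0                       ∎
      where
      open ≡-Reasoning
      f : ℕ → ℕ
      f i = 𝟙 (n ∣? suc i)

-- The descent on pairs of residues and its common point (1 , 0).

module Walk where
  open import Data.Nat
  open import Data.Nat.Properties
  open import Data.Nat.Coprimality using (Coprime; coprime-Bézout; coprime-divisor)
  open import Data.Nat.Divisibility
  open import Data.Nat.DivMod
  open import Data.Nat.GCD using (module Bézout)
  open import Data.Nat.Primality using (Prime; prime⇒irreducible)
  open import Data.Nat.Solver using (module +-*-Solver)
  open import Data.Product using (_×_; _,_; ∃)
  open import Data.Sum using (inj₁; inj₂)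
  open import Level using (0ℓ)
  open import Relation.Binary.Bundles using (Setoid)
  import Relation.Binary.Reasoning.Setoid as SetoidReasoning
  open import Relation.Binary.PropositionalEquality
  open import Relation.Nullary using (¬_; yes; no; contradiction)

  -- The total of `f` over the 2 ^ n descendants n generations below a / b. Plain pairs replace
  -- fractions because residues such as (1 , 0) also have to serve as starting points.
  paths : (ℕ → ℕ → ℕ) → ℕ → ℕ → ℕ → ℕ
  paths f zero    a b = f a b
  paths f (suc n) a b = paths f n a (a + b) + paths f n (a + b) b

  -- Exchanging numerator and denominator exchanges the two children.
  paths-flip : ∀ f n a b → paths (λ x y → f y x) n a b ≡ paths f n b a
  paths-flip f zero    a b = refl
  paths-flip f (suc n) a b rewrite +-comm a b =
    trans (cong₂ _+_ (paths-flip f n a (b + a)) (paths-flip f n (b + a) b)) (+-comm _ (paths f n b (b + a)))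

  module _ (M : ℕ) .⦃ _ : NonZero M ⦄ where

    infix 4 _≋_

    record _≋_ (a b : ℕ) : Set where
      constructor mod
      field remainders : a % M ≡ b % M

    ≡⇒≋ : ∀ {a b} → a ≡ b → a ≋ b
    ≡⇒≋ refl = mod refl

    ≋-sym : ∀ {a b} → a ≋ b → b ≋ a
    ≋-sym (mod e) = mod (sym e)

    ≋-trans : ∀ {a b c} → a ≋ b → b ≋ c → a ≋ c
    ≋-trans (mod e) (mod f) = mod (trans e f)

    ≋-setoid : Setoid 0ℓ 0ℓ
    ≋-setoid = record { Carrier = ℕ ; _≈_ = _≋_ ; isEquivalence = record { refl = mod refl ; sym = ≋-sym ; trans = ≋-trans } }

    module ≋-Reasoning = SetoidReasoning ≋-setoid

    +-cong-≋ : ∀ {a a′ b b′} → a ≋ a′ → b ≋ b′ → a + b ≋ a′ + b′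
    +-cong-≋ {a} {a′} {b} {b′} (mod e) (mod f) = mod (trans (%-distribˡ-+ a b M)
      (trans (cong₂ (λ x y → (x + y) % M) e f) (sym (%-distribˡ-+ a′ b′ M))))

    *-cong-≋ : ∀ {a a′ b b′} → a ≋ a′ → b ≋ b′ → a * b ≋ a′ * b′
    *-cong-≋ {a} {a′} {b} {b′} (mod e) (mod f) = mod (trans (%-distribˡ-* a b M)
      (trans (cong₂ (λ x y → (x * y) % M) e f) (sym (%-distribˡ-* a′ b′ M))))

    +-congˡ-≋ : ∀ a {b b′} → b ≋ b′ → a + b ≋ a + b′
    +-congˡ-≋ a = +-cong-≋ {a} (mod refl)

    +-congʳ-≋ : ∀ b {a a′} → a ≋ a′ → a + b ≋ a′ + b
    +-congʳ-≋ b e = +-cong-≋ {b = b} e (mod refl)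

    *-congˡ-≋ : ∀ a {b b′} → b ≋ b′ → a * b ≋ a * b′
    *-congˡ-≋ a = *-cong-≋ {a} (mod refl)

    *-congʳ-≋ : ∀ b {a a′} → a ≋ a′ → a * b ≋ a′ * b
    *-congʳ-≋ b e = *-cong-≋ {b = b} e (mod refl)

    %-≋ : ∀ a → a % M ≋ a
    %-≋ a = mod (m%n%n≡m%n a M)

    +M-≋ : ∀ a → a + M ≋ a
    +M-≋ a = mod ([m+n]%n≡m%n a M)

    +kM-≋ : ∀ a k → a + k * M ≋ a
    +kM-≋ a k = mod ([m+kn]%n≡m%n a k M)

    ≋-resp-∣ : ∀ {d a b} → d ∣ M → a ≋ b → d ∣ a → d ∣ b
    ≋-resp-∣ {d} d∣M (mod e) d∣a = ∣n∣m%n⇒∣m d∣M (subst (d ∣_) e (%-presˡ-∣ d∣a d∣M))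

    Respects : (ℕ → ℕ → ℕ) → Set
    Respects f = ∀ {a a′ b b′} → a ≋ a′ → b ≋ b′ → f a b ≡ f a′ b′

    paths-respects : ∀ {f} → Respects f → ∀ n → Respects (paths f n)
    paths-respects f-resp zero    e f = f-resp e f
    paths-respects f-resp (suc n) e f =
      cong₂ _+_ (paths-respects f-resp n e (+-cong-≋ e f)) (paths-respects f-resp n (+-cong-≋ e f) f)

    data Reaches[1,0] : ℕ → ℕ → ℕ → Set where
      here  : ∀ {a b} → a ≋ 1 → b ≋ 0 → Reaches[1,0] 0 a b
      left  : ∀ {n a b} → Reaches[1,0] n a (a + b) → Reaches[1,0] (suc n) a b
      right : ∀ {n a b} → Reaches[1,0] n (a + b) b → Reaches[1,0] (suc n) a b

    -- The right child of (1 , 0) is (1 , 0) again, so the descent can wait there. This turns a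
    -- bound on the number of steps into an exact number common to all starting pairs.
    stay : ∀ n {a b} → a ≋ 1 → b ≋ 0 → Reaches[1,0] n a b
    stay zero    e f = here e f
    stay (suc n) e f = right (stay n (+-cong-≋ e f) f)

    delay : ∀ {m n a b} → m ≤ n → Reaches[1,0] m a b → Reaches[1,0] n a b
    delay z≤n       (here e f) = stay _ e f
    delay (s≤s m≤n) (left r)   = left (delay m≤n r)
    delay (s≤s m≤n) (right r)  = right (delay m≤n r)

    lefts : ∀ k {n a b} → Reaches[1,0] n a (k * a + b) → Reaches[1,0] (k + n) a b
    lefts zero    r = r
    lefts (suc k) {n} {a} {b} r = left (lefts k (subst (Reaches[1,0] n a) (lemma a k b) r))
      where
      open +-*-Solver
      lemma : ∀ a k b → a + k * a + b ≡ k * a + (a + b)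
      lemma = solve 3 (λ a k b → a :+ k :* a :+ b := k :* a :+ (a :+ b)) refl

    rights : ∀ k {n a b} → Reaches[1,0] n (k * b + a) b → Reaches[1,0] (k + n) a b
    rights zero    r = r
    rights (suc k) {n} {a} {b} r = right (rights k (subst (λ x → Reaches[1,0] n x b) (lemma a k b) r))
      where
      open +-*-Solver
      lemma : ∀ a k b → b + k * b + a ≡ k * b + (a + b)
      lemma = solve 3 (λ a k b → b :+ k :* b :+ a := k :* b :+ (a :+ b)) refl

    -- Represents - a modulo M without leaving the natural numbers, as M - 1 is congruent to - 1.
    -1* : ℕ → ℕ
    -1* a = pred M * a

    -1*-+ : ∀ a → -1* a + a ≋ 0
    -1*-+ a = ≋-trans (≡⇒≋ (trans (+-comm (pred M * a) a) (trans (cong (_* a) (suc-pred M)) (*-comm M a))))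
      (+kM-≋ 0 a)

    inverse : ∀ {a} → Coprime a M → ∃ λ t → t * a ≋ 1
    inverse {a} a⊥M with coprime-Bézout a⊥M
    ... | Bézout.+- x y eq = x , ≋-trans (≡⇒≋ (sym eq)) (+kM-≋ 1 y)
    -- Here 1 + x a is a multiple of M, so the inverse is - x.
    ... | Bézout.-+ x y eq = -1* x , (begin
      -1* x * a                  ≈⟨ +M-≋ (-1* x * a) ⟨
      -1* x * a + M              ≡⟨ cong (-1* x * a +_) (suc-pred M) ⟨
      m * x * a + suc m          ≡⟨ solve 3 (λ m x a → m :* x :* a :+ (con 1 :+ m) := con 1 :+ m :* (con 1 :+ x :* a)) refl m x a ⟩
      1 + m * (1 + x * a)        ≡⟨ cong (λ z → 1 + m * z) eq ⟩
      1 + m * (y * M)            ≡⟨ cong (1 +_) (*-assoc m y M) ⟨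
      1 + m * y * M              ≈⟨ +kM-≋ 1 (m * y) ⟩
      1                          ∎)
      where
      m : ℕ
      m = pred M
      open +-*-Solver
      open ≋-Reasoning

    -- With b invertible, j = (1 - a) / b right steps make the first entry a + j b ≡ 1, and then i =
    -- - b left steps make the second b + i ≡ 0. Reducing i and j modulo M bounds the number of
    -- steps by M + M.
    reaches-from-unit : ∀ a {b} → Coprime b M → Reaches[1,0] (M + M) a b
    reaches-from-unit a {b} b⊥M with t , tb≋1 ← inverse b⊥M =
      delay (+-mono-≤ (m%n≤n (t * (1 + -1* a)) M) (subst (_≤ M) (sym (+-identityʳ i)) (m%n≤n (-1* b) M)))
        (rights j (lefts i (here a′≋1 ia′+b≋0)))
      where
      open ≋-Reasoning
      i j a′ : ℕ
      i = -1* b % M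
      j = t * (1 + -1* a) % M
      a′ = j * b + a
      a′≋1 : a′ ≋ 1
      a′≋1 = begin
        j * b + a                     ≈⟨ +-congʳ-≋ a (*-congʳ-≋ b (%-≋ (t * (1 + -1* a)))) ⟩
        t * (1 + -1* a) * b + a       ≡⟨ solve 4 (λ t n b a → t :* (con 1 :+ n) :* b :+ a := (con 1 :+ n) :* (t :* b) :+ a) refl t (-1* a) b a ⟩
        (1 + -1* a) * (t * b) + a     ≈⟨ +-congʳ-≋ a (*-congˡ-≋ (1 + -1* a) tb≋1) ⟩
        (1 + -1* a) * 1 + a           ≡⟨ cong (_+ a) (*-identityʳ (1 + -1* a)) ⟩
        1 + (-1* a + a)               ≈⟨ +-congˡ-≋ 1 (-1*-+ a) ⟩
        1                             ∎
        where open +-*-Solver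
      ia′+b≋0 : i * a′ + b ≋ 0
      ia′+b≋0 = begin
        i * a′ + b         ≈⟨ +-congʳ-≋ b (*-cong-≋ (%-≋ (-1* b)) a′≋1) ⟩
        -1* b * 1 + b      ≡⟨ cong (_+ b) (*-identityʳ (-1* b)) ⟩
        -1* b + b          ≈⟨ -1*-+ b ⟩
        0                  ∎

  -- A common divisor d of b and p ^ (k + 1) is prime to p, for otherwise p would divide b; hence d
  -- already divides p ^ k.
  ∤⇒coprime : ∀ {p} → Prime p → ∀ {b} → ¬ (p ∣ b) → ∀ k → Coprime b (p ^ k)
  ∤⇒coprime pr p∤b zero    (_ , d∣1) = ∣1⇒≡1 d∣1
  ∤⇒coprime {p} pr {b} p∤b (suc k) {d} (d∣b , d∣pᵏ⁺¹) =
    ∤⇒coprime pr p∤b k (d∣b , coprime-divisor d⊥p d∣pᵏ⁺¹)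
    where
    d⊥p : Coprime d p
    d⊥p (e∣d , e∣p) with prime⇒irreducible pr e∣p
    ... | inj₁ e≡1  = e≡1
    ... | inj₂ refl = contradiction (∣-trans e∣d d∣b) p∤b

  Primitive : ℕ → ℕ → ℕ → Set
  Primitive p a b = ¬ (p ∣ a × p ∣ b)

  left-primitive : ∀ {p a b} → Primitive p a b → Primitive p a (a + b)
  left-primitive prim (p∣a , p∣a+b) = prim (p∣a , ∣m+n∣m⇒∣n p∣a+b p∣a)

  right-primitive : ∀ {p a b} → Primitive p a b → Primitive p (a + b) b
  right-primitive {p} {a} {b} prim (p∣a+b , p∣b) = prim (∣m+n∣m⇒∣n (subst (p ∣_) (+-comm a b) p∣a+b) p∣b , p∣b)

  -- If p divides b, it does not divide a, and one left step replaces b by a + b, which is prime to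
  -- p. The `suc` in the count pays for this step.
  reaches : ∀ {p} (pr : Prime p) k .⦃ _ : NonZero (p ^ k) ⦄ {a b} → Primitive p a b →
            Reaches[1,0] (p ^ k) (suc (p ^ k + p ^ k)) a b
  reaches {p} pr k {a} {b} prim with p ∣? b
  ... | no p∤b  = delay (p ^ k) (n≤1+n _) (reaches-from-unit (p ^ k) a (∤⇒coprime pr p∤b k))
  ... | yes p∣b = left (reaches-from-unit (p ^ k) a
        (∤⇒coprime pr (λ p∣a+b → right-primitive {a = a} prim (p∣a+b , p∣b)) k))

-- Contraction of the oscillation and invariance of the average.

module Mixing where
  open import Data.Nat
  open import Data.Nat.Properties
  open import Data.Nat.Divisibility
  open import Data.Nat.Primality using (Prime)
  open import Data.Nat.Solver using (module +-*-Solver)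
  open import Data.Product using (_×_; _,_; proj₁; proj₂; ∃)
  open import Relation.Binary.PropositionalEquality
  open import Relation.Nullary using (Dec; yes; no; ¬?; _×-dec_)
  open Sums
  open Walk

  primitive? : ∀ p a b → Dec (Primitive p a b)
  primitive? p a b = ¬? (p ∣? a ×-dec p ∣? b)

  ∑∑ : ℕ → (ℕ → ℕ → ℕ) → ℕ
  ∑∑ M g = ∑ M (λ i → ∑ M (g i))

  ∑∑-* : ∀ M x g → ∑∑ M (λ i j → g i j * x) ≡ x * ∑∑ M g
  ∑∑-* M x g = trans
    (∑-cong M (λ i → trans (∑-cong M (λ j → *-comm (g i j) x)) (∑-*ˡ M x (g i))))
    (∑-*ˡ M x (λ i → ∑ M (g i)))

  module _ (M : ℕ) .⦃ _ : NonZero M ⦄ where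

    respects⇒periodicˡ : ∀ {g} → Respects M g → ∀ j → Periodic M (λ i → g i j)
    respects⇒periodicˡ g-resp j i = g-resp (≋-trans M (≡⇒≋ M (+-comm M i)) (+M-≋ M i)) (≡⇒≋ M refl)

    respects⇒periodicʳ : ∀ {g} → Respects M g → ∀ i → Periodic M (g i)
    respects⇒periodicʳ g-resp i j = g-resp (≡⇒≋ M refl) (≋-trans M (≡⇒≋ M (+-comm M j)) (+M-≋ M j))

    -- For fixed i, replacing j by i + j only rotates a full period of j.
    ∑∑-left : ∀ {g} → Respects M g → ∑∑ M (λ i j → g i (i + j)) ≡ ∑∑ M g
    ∑∑-left {g} g-resp = ∑-cong M (λ i → ∑-shift {M} {g i} (respects⇒periodicʳ g-resp i) i)

    ∑∑-right : ∀ {g} → Respects M g → ∑∑ M (λ i j → g (i + j) j) ≡ ∑∑ M g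
    ∑∑-right {g} g-resp = begin
      ∑∑ M (λ i j → g (i + j) j)               ≡⟨ ∑-comm M M (λ i j → g (i + j) j) ⟩
      ∑∑ M (λ j i → g (i + j) j)               ≡⟨ ∑-cong M (λ j → ∑-cong M (λ i → cong (λ x → g x j) (+-comm i j))) ⟩
      ∑∑ M (λ j i → g (j + i) j)               ≡⟨ ∑-cong M (λ j → ∑-shift {M} {λ i → g i j} (respects⇒periodicˡ g-resp j) j) ⟩
      ∑∑ M (λ j i → g i j)                     ≡⟨ ∑-comm M M g ⟨
      ∑∑ M g                                   ∎
      where open ≡-Reasoning

  module _ {p} (pr : Prime p) (k : ℕ) .⦃ _ : NonZero (p ^ k) ⦄ {f} (f-resp : Respects (p ^ k) f) where
    private
      M N q : ℕ
      M = p ^ k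
      N = suc (M + M)
      q = pred (2 ^ N)

      C : ℕ → ℕ → ℕ → ℕ
      C = paths f

      double : ∀ x y → 2 * x * y ≡ x * y + x * y
      double = solve 2 (λ x y → con 2 :* x :* y := x :* y :+ x :* y) refl
        where open +-*-Solver

      1+q≡2^N : suc q ≡ 2 ^ N
      1+q≡2^N = suc-pred (2 ^ N) ⦃ m^n≢0 2 N ⦄

    Between : ℕ → ℕ → ℕ → Set
    Between n lo hi = ∀ a b → Primitive p a b → lo ≤ C n a b × C n a b ≤ hi

    -- All descendants of a primitive pair are primitive, so the bounds apply to each of the 2 ^ m
    -- pairs reached after m steps.
    between-+ : ∀ m {n lo hi} → Between n lo hi → Between (m + n) (2 ^ m * lo) (2 ^ m * hi)
    between-+ zero {n} {lo} {hi} B a b prim =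
      subst (_≤ C n a b) (sym (*-identityˡ lo)) (proj₁ (B a b prim)) ,
      subst (C n a b ≤_) (sym (*-identityˡ hi)) (proj₂ (B a b prim))
    between-+ (suc m) {n} {lo} {hi} B a b prim =
      subst (_≤ C (suc m + n) a b) (sym (double (2 ^ m) lo)) (+-mono-≤ (proj₁ l) (proj₁ r)) ,
      subst (C (suc m + n) a b ≤_) (sym (double (2 ^ m) hi)) (+-mono-≤ (proj₂ l) (proj₂ r))
      where
      l = between-+ m B a (a + b) (left-primitive prim)
      r = between-+ m B (a + b) b (right-primitive {a = a} prim)

    -- The inductive step along a path to (1 , 0): u is the count of the child on the path, v that
    -- of the other child, for which only the general bounds are known. Keeping `lo` and `hi` beside
    -- the counts avoids subtraction.
    through-child : ∀ c x {lo hi} u v → c + x * lo ≤ u + lo × u + hi ≤ c + x * hi → x * lo ≤ v × v ≤ x * hi →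
                    c + 2 * x * lo ≤ u + v + lo × u + v + hi ≤ c + 2 * x * hi
    through-child c x {lo} {hi} u v (lowerᵘ , upperᵘ) (lowerᵛ , upperᵛ) =
      (begin
        c + 2 * x * lo              ≡⟨ split lo ⟨
        (c + x * lo) + x * lo       ≤⟨ +-mono-≤ lowerᵘ lowerᵛ ⟩
        (u + lo) + v                ≡⟨ swap lo ⟩
        u + v + lo                  ∎) ,
      (begin
        u + v + hi                  ≡⟨ swap hi ⟨
        (u + hi) + v                ≤⟨ +-mono-≤ upperᵘ upperᵛ ⟩
        (c + x * hi) + x * hi       ≡⟨ split hi ⟩
        c + 2 * x * hi              ∎)
      where
      open +-*-Solver
      open ≤-Reasoning
      split : ∀ l → (c + x * l) + x * l ≡ c + 2 * x * l
      split = solve 3 (λ c x l → (c :+ x :* l) :+ x :* l := c :+ con 2 :* x :* l) refl c x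
      swap : ∀ l → (u + l) + v ≡ u + v + l
      swap = solve 3 (λ u v l → (u :+ l) :+ v := u :+ v :+ l) refl u v

    -- One of the 2 ^ m words of length m leads to (1 , 0), so that only the others contribute to
    -- the oscillation.
    through-[1,0] : ∀ {m n lo hi a b} → Between n lo hi → Primitive p a b → Reaches[1,0] M m a b →
                    C n 1 0 + 2 ^ m * lo ≤ C (m + n) a b + lo × C (m + n) a b + hi ≤ C n 1 0 + 2 ^ m * hi
    through-[1,0] {n = n} {lo} {hi} {a} {b} B prim (here a≋1 b≋0) =
      ≤-reflexive (cong₂ _+_ (sym eq) (*-identityˡ lo)) , ≤-reflexive (cong₂ _+_ eq (sym (*-identityˡ hi)))
      where
      eq : C n a b ≡ C n 1 0
      eq = paths-respects M f-resp n a≋1 b≋0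
    through-[1,0] {suc m} {n} {a = a} {b} B prim (left r) = through-child (C n 1 0) (2 ^ m)
      (C (m + n) a (a + b)) _ (through-[1,0] B (left-primitive prim) r)
      (between-+ m B (a + b) b (right-primitive {a = a} prim))
    through-[1,0] {suc m} {n} {lo} {hi} {a} {b} B prim (right r) =
      subst (λ x → C n 1 0 + 2 ^ suc m * lo ≤ x + lo × x + hi ≤ C n 1 0 + 2 ^ suc m * hi)
        (+-comm (C (m + n) (a + b) b) (C (m + n) a (a + b)))
        (through-child (C n 1 0) (2 ^ m) (C (m + n) (a + b) b) _ (through-[1,0] B (right-primitive {a = a} prim) r)
          (between-+ m B a (a + b) (left-primitive prim)))

    -- Both new bounds contain the same term from the descent through (1 , 0), so the gap hi - lo is
    -- multiplied by q = 2 ^ N - 1, while the number of words is multiplied by 2 ^ N.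
    contract : ∀ {n lo hi} → Between n lo hi → Between (N + n) (C n 1 0 + q * lo) (C n 1 0 + q * hi)
    contract {n} {lo} {hi} B a b prim with lower , upper ← through-[1,0] B prim (reaches pr k prim) =
      +-cancelʳ-≤ lo _ _ (subst (_≤ C (N + n) a b + lo) (eq lo) lower) ,
      +-cancelʳ-≤ hi _ _ (subst (C (N + n) a b + hi ≤_) (eq hi) upper)
      where
      open +-*-Solver
      eq : ∀ x → C n 1 0 + 2 ^ N * x ≡ C n 1 0 + q * x + x
      eq x = trans (cong (λ y → C n 1 0 + y * x) (sym 1+q≡2^N))
        (solve 3 (λ c q x → c :+ (con 1 :+ q) :* x := c :+ q :* x :+ x) refl (C n 1 0) q x)

    -- With values 0 and 1 the initial gap is 1, and each of the r rounds of N steps multiplies it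
    -- by q.
    oscillation : (∀ a b → f a b ≤ 1) → ∀ r → ∃ λ lo → Between (r * N) lo (lo + q ^ r)
    oscillation f≤1 zero    = 0 , λ a b _ → z≤n , f≤1 a b
    oscillation f≤1 (suc r) with lo , B ← oscillation f≤1 r =
      C (r * N) 1 0 + q * lo , subst (Between (suc r * N) _)
        (solve 4 (λ c q l x → c :+ q :* (l :+ x) := c :+ q :* l :+ q :* x) refl (C (r * N) 1 0) q lo (q ^ r))
        (contract B)
      where open +-*-Solver

    -- Divided by 2 ^ n, this is the number of primitive pairs modulo M times the average
    -- proportion, the quantity that stays constant.
    total : ℕ → ℕ
    total n = ∑∑ M (λ i j → 𝟙 (primitive? p i j) * C n i j)

    module _ (p∣M : p ∣ M) where

      primitive-respects : Respects M (λ a b → 𝟙 (primitive? p a b))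
      primitive-respects e f = 𝟙-cong _ _
        (λ prim (p∣a , p∣b) → prim (≋-resp-∣ M p∣M (≋-sym M e) p∣a , ≋-resp-∣ M p∣M (≋-sym M f) p∣b))
        (λ prim (p∣a , p∣b) → prim (≋-resp-∣ M p∣M e p∣a , ≋-resp-∣ M p∣M f p∣b))

      -- Both children maps permute the primitive pairs modulo M.
      total-suc : ∀ n → total (suc n) ≡ 2 * total n
      total-suc n = begin
        ∑∑ M (λ i j → 𝟙 (primitive? p i j) * (C n i (i + j) + C n (i + j) j))   ≡⟨ ∑-cong M (λ i → ∑-cong M (λ j → split i j)) ⟩
        ∑∑ M (λ i j → g i (i + j) + g (i + j) j)                              ≡⟨ ∑-cong M (λ i → ∑-+ M (λ j → g i (i + j)) (λ j → g (i + j) j)) ⟩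
        ∑ M (λ i → ∑ M (λ j → g i (i + j)) + ∑ M (λ j → g (i + j) j))       ≡⟨ ∑-+ M (λ i → ∑ M (λ j → g i (i + j))) (λ i → ∑ M (λ j → g (i + j) j)) ⟩
        ∑∑ M (λ i j → g i (i + j)) + ∑∑ M (λ i j → g (i + j) j)                 ≡⟨ cong₂ _+_ (∑∑-left M g-resp) (trans (∑∑-right M g-resp) (sym (+-identityʳ _))) ⟩
        2 * total n                                                         ∎
        where
        open ≡-Reasoning
        g : ℕ → ℕ → ℕ
        g i j = 𝟙 (primitive? p i j) * C n i j
        g-resp : Respects M g
        g-resp e f = cong₂ _*_ (primitive-respects e f) (paths-respects M f-resp n e f)
        split : ∀ i j → 𝟙 (primitive? p i j) * (C n i (i + j) + C n (i + j) j) ≡ g i (i + j) + g (i + j) j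
        split i j = trans (*-distribˡ-+ (𝟙 (primitive? p i j)) (C n i (i + j)) (C n (i + j) j)) (cong₂ _+_
          (cong (_* C n i (i + j)) (𝟙-cong (primitive? p i j) (primitive? p i (i + j)) left-primitive (λ prim (p∣i , p∣j) → prim (p∣i , ∣m∣n⇒∣m+n p∣i p∣j))))
          (cong (_* C n (i + j) j) (𝟙-cong (primitive? p i j) (primitive? p (i + j) j) (right-primitive {a = i}) (λ prim (p∣i , p∣j) → prim (∣m∣n⇒∣m+n p∣i p∣j , p∣j)))))

      total≡ : ∀ n → total n ≡ 2 ^ n * total 0
      total≡ zero    = sym (*-identityˡ (total 0))
      total≡ (suc n) = trans (total-suc n) (trans (cong (2 *_) (total≡ n)) (sym (*-assoc 2 (2 ^ n) (total 0))))

    total-bounds : ∀ {n lo hi} → Between n lo hi →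
                   lo * ∑∑ M (λ i j → 𝟙 (primitive? p i j)) ≤ total n × total n ≤ hi * ∑∑ M (λ i j → 𝟙 (primitive? p i j))
    total-bounds {n} {lo} {hi} B =
      subst (_≤ total n) (∑∑-* M lo (λ i j → 𝟙 (primitive? p i j))) (∑-mono M (λ i → ∑-mono M (λ j → proj₁ (pointwise i j)))) ,
      subst (total n ≤_) (∑∑-* M hi (λ i j → 𝟙 (primitive? p i j))) (∑-mono M (λ i → ∑-mono M (λ j → proj₂ (pointwise i j))))
      where
      pointwise : ∀ i j → 𝟙 (primitive? p i j) * lo ≤ 𝟙 (primitive? p i j) * C n i j ×
                          𝟙 (primitive? p i j) * C n i j ≤ 𝟙 (primitive? p i j) * hi
      pointwise i j with primitive? p i j
      ... | yes prim = *-monoʳ-≤ 1 (proj₁ (B i j prim)) , *-monoʳ-≤ 1 (proj₂ (B i j prim))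
      ... | no _     = z≤n , z≤n

  -- Bernoulli's inequality (1 + 1 / q) ^ (r + 1) ≥ 1 + (r + 1) / q, cleared of denominators.
  bernoulli : ∀ q r → (q + suc r) * q ^ r ≤ suc q ^ suc r
  bernoulli q zero    = ≤-reflexive (solve 1 (λ q → (q :+ con 1) :* con 1 := (con 1 :+ q) :* con 1) refl q)
    where open +-*-Solver
  bernoulli q (suc r) = begin
    (q + suc (suc r)) * (q * q ^ r)                ≤⟨ m≤m+n _ (suc r * q ^ r) ⟩
    (q + suc (suc r)) * (q * q ^ r) + suc r * q ^ r  ≡⟨ solve 3 (λ q r x → (q :+ (con 2 :+ r)) :* (q :* x) :+ (con 1 :+ r) :* x := (con 1 :+ q) :* ((q :+ (con 1 :+ r)) :* x)) refl q r (q ^ r) ⟩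
    suc q * ((q + suc r) * q ^ r)                  ≤⟨ *-monoʳ-≤ (suc q) (bernoulli q r) ⟩
    suc q * suc q ^ suc r                          ∎
    where
    open +-*-Solver
    open ≤-Reasoning

  -- The exponent q E + 1 is chosen so that the Bernoulli factor q + (q E + 1) exceeds q E.
  geometric : ∀ q .⦃ _ : NonZero q ⦄ E → q ^ suc (q * E) * E < suc q ^ suc (q * E)
  geometric q E = begin-strict
    q * q ^ r * E          ≡⟨ solve 3 (λ q x E → q :* x :* E := (q :* E) :* x) refl q (q ^ r) E ⟩
    q * E * q ^ r          <⟨ *-monoˡ-< (q ^ r) ⦃ m^n≢0 q r ⦄ (≤-trans (n<1+n r) (m≤n+m (suc r) q)) ⟩
    (q + suc r) * q ^ r    ≤⟨ bernoulli q r ⟩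
    suc q ^ suc r          ∎
    where
    open +-*-Solver
    open ≤-Reasoning
    r : ℕ
    r = q * E

-- Equidistribution on the projective line over ℤ / p ^ (κ + 1).

module Equidistribution where
  open import Data.Nat
  open import Data.Nat.Properties
  open import Data.Nat.Divisibility
  open import Data.Nat.Primality using (Prime; prime⇒nonZero; prime⇒nonTrivial)
  open import Data.Nat.Solver using (module +-*-Solver)
  open import Data.Product using (_×_; _,_; proj₂; ∃)
  open import Function using (_∘_)
  open import Relation.Binary.PropositionalEquality
  open import Relation.Nullary using (yes; no; ¬?; _×-dec_)
  open Sums
  open Walk
  open Mixing

  -- Both c and x / K lie in an interval of length g < e x / E, hence differ by less than e x / E.
  -- Dividing by x, which is 2 ^ n in the application, puts c / x within e / E of 1 / K.
  squeeze : ∀ {c lo g x} K E e .⦃ _ : NonZero K ⦄ → lo ≤ c × c ≤ lo + g →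
            lo * K ≤ x × x ≤ (lo + g) * K → g * E < e * x →
            c * (K * E) < (E + e * K) * x × x * E < (c * E + e * x) * K
  squeeze {c} {lo} {g} {x} K E e (lo≤c , c≤hi) (loK≤x , x≤hiK) gap =
    (begin-strict
      c * (K * E)                     ≤⟨ *-monoˡ-≤ (K * E) c≤hi ⟩
      (lo + g) * (K * E)              ≡⟨ solve 4 (λ l g K E → (l :+ g) :* (K :* E) := E :* (l :* K) :+ g :* E :* K) refl lo g K E ⟩
      E * (lo * K) + g * E * K        ≤⟨ +-monoˡ-≤ (g * E * K) (*-monoʳ-≤ E loK≤x) ⟩
      E * x + g * E * K               <⟨ +-monoʳ-< (E * x) (*-monoˡ-< K gap) ⟩
      E * x + e * x * K               ≡⟨ solve 4 (λ E x e K → E :* x :+ e :* x :* K := (E :+ e :* K) :* x) refl E x e K ⟩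
      (E + e * K) * x                 ∎) ,
    (begin-strict
      x * E                           ≤⟨ *-monoˡ-≤ E x≤hiK ⟩
      (lo + g) * K * E                ≡⟨ solve 4 (λ l g K E → (l :+ g) :* K :* E := (l :* E :+ g :* E) :* K) refl lo g K E ⟩
      (lo * E + g * E) * K            <⟨ *-monoˡ-< K (+-mono-≤-< (*-monoˡ-≤ E lo≤c) gap) ⟩
      (c * E + e * x) * K             ∎)
    where
    open ≤-Reasoning
    open +-*-Solver

  ∃-power : ∀ y E → 2 ≤ y → ∃ λ r → pred y ^ r * E < y ^ r
  ∃-power (suc q) E (s≤s 1≤q) = suc (q * E) , geometric q ⦃ >-nonZero 1≤q ⦄ E

  -- After r rounds of N generations, each of m further ones doubles both the gap and the number of
  -- words, so the ratio ((2 ^ N - 1) / 2 ^ N) ^ r persists.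
  power-bound : ∀ m N r e E .⦃ _ : NonZero e ⦄ → pred (2 ^ N) ^ r * E < (2 ^ N) ^ r →
                2 ^ m * pred (2 ^ N) ^ r * E < e * 2 ^ (m + r * N)
  power-bound m N r e E h = begin-strict
    2 ^ m * pred (2 ^ N) ^ r * E    ≡⟨ *-assoc (2 ^ m) (pred (2 ^ N) ^ r) E ⟩
    2 ^ m * (pred (2 ^ N) ^ r * E)  <⟨ *-monoʳ-< (2 ^ m) ⦃ m^n≢0 2 m ⦄ h ⟩
    2 ^ m * (2 ^ N) ^ r             ≡⟨ cong (2 ^ m *_) (trans (^-*-assoc 2 N r) (cong (2 ^_) (*-comm N r))) ⟩
    2 ^ m * 2 ^ (r * N)             ≡⟨ ^-distribˡ-+-* 2 m (r * N) ⟨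
    2 ^ (m + r * N)                 ≤⟨ m≤n*m (2 ^ (m + r * N)) e ⟩
    e * 2 ^ (m + r * N)             ∎
    where open ≤-Reasoning

  module _ {p} (pr : Prime p) (κ s : ℕ) where
    private
      instance
        p≢0 : NonZero p
        p≢0 = prime⇒nonZero pr
        P≢0 : NonZero (p ^ κ)
        P≢0 = m^n≢0 p κ
        M≢0 : NonZero (p ^ suc κ)
        M≢0 = m^n≢0 p (suc κ)

      -- t is the number of units modulo M, and K the number of points of the projective line over ℤ
      -- / M, each of which is represented by t primitive pairs.
      M P t K : ℕ
      M = p ^ suc κ
      P = p ^ κ
      t = M ∸ P
      K = M + P

      p∣M : p ∣ M
      p∣M = m∣m*n P

      t+P≡M : t + P ≡ M
      t+P≡M = m∸n+n≡m (m≤n*m P p)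

    -- On primitive pairs, the indicator of the point (- s : 1) of the projective line.
    target : ℕ → ℕ → ℕ
    target a b = 𝟙 (M ∣? a + s * b)

    target-respects : Respects M target
    target-respects {a} {a′} {b} {b′} e f = 𝟙-cong _ _
      (≋-resp-∣ M ∣-refl a+sb≋a′+sb′) (≋-resp-∣ M ∣-refl (≋-sym M a+sb≋a′+sb′))
      where a+sb≋a′+sb′ = +-cong-≋ M e (*-congˡ-≋ M s f)

    ∑-multiples : ∑ M (λ i → 𝟙 (p ∣? i)) ≡ P
    ∑-multiples = begin
      ∑ (p * P) (λ i → 𝟙 (p ∣? i))     ≡⟨ cong (λ m → ∑ m (λ i → 𝟙 (p ∣? i))) (*-comm p P) ⟩
      ∑ (P * p) (λ i → 𝟙 (p ∣? i))     ≡⟨ ∑-periods {p} {λ i → 𝟙 (p ∣? i)} (∣?-periodic p 0) P ⟩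
      P * ∑ p (λ i → 𝟙 (p ∣? i))       ≡⟨ cong (P *_) (∑-∣? p 0) ⟩
      P * 1                            ≡⟨ *-identityʳ P ⟩
      P                                ∎
      where open ≡-Reasoning

    ∑-nonMultiples : ∑ M (λ i → 𝟙 (¬? (p ∣? i))) ≡ t
    ∑-nonMultiples = +-cancelʳ-≡ P _ t (begin
      ∑ M (λ i → 𝟙 (¬? (p ∣? i))) + P                          ≡⟨ cong (∑ M (λ i → 𝟙 (¬? (p ∣? i))) +_) ∑-multiples ⟨
      ∑ M (λ i → 𝟙 (¬? (p ∣? i))) + ∑ M (λ i → 𝟙 (p ∣? i))     ≡⟨ ∑-+ M (λ i → 𝟙 (¬? (p ∣? i))) (λ i → 𝟙 (p ∣? i)) ⟨
      ∑ M (λ i → 𝟙 (¬? (p ∣? i)) + 𝟙 (p ∣? i))                 ≡⟨ ∑-cong M (λ i → 𝟙-¬ (p ∣? i)) ⟩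
      ∑ M (λ _ → 1)                                            ≡⟨ trans (∑-const M 1) (*-identityʳ M) ⟩
      M                                                        ≡⟨ t+P≡M ⟨
      t + P                                                    ∎)
      where open ≡-Reasoning

    ∑∑-imprimitive : ∑∑ M (λ i j → 𝟙 (p ∣? i ×-dec p ∣? j)) ≡ P * P
    ∑∑-imprimitive = begin
      ∑∑ M (λ i j → 𝟙 (p ∣? i ×-dec p ∣? j))        ≡⟨ ∑-cong M (λ i → ∑-cong M (λ j → trans (𝟙-× (p ∣? i) (p ∣? j)) (*-comm (𝟙 (p ∣? i)) _))) ⟩
      ∑∑ M (λ i j → 𝟙 (p ∣? j) * 𝟙 (p ∣? i))        ≡⟨ ∑-comm M M (λ i j → 𝟙 (p ∣? j) * 𝟙 (p ∣? i)) ⟩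
      ∑∑ M (λ j i → 𝟙 (p ∣? j) * 𝟙 (p ∣? i))        ≡⟨ ∑-cong M (λ j → trans (∑-*ˡ M (𝟙 (p ∣? j)) (λ i → 𝟙 (p ∣? i))) (trans (cong (𝟙 (p ∣? j) *_) ∑-multiples) (*-comm (𝟙 (p ∣? j)) P))) ⟩
      ∑ M (λ j → P * 𝟙 (p ∣? j))                    ≡⟨ ∑-*ˡ M P (λ j → 𝟙 (p ∣? j)) ⟩
      P * ∑ M (λ j → 𝟙 (p ∣? j))                    ≡⟨ cong (P *_) ∑-multiples ⟩
      P * P                                         ∎
      where open ≡-Reasoning

    -- The imprimitive pairs number P * P, and M * M - P * P factors as (M - P) (M + P).
    ∑∑-primitive : ∑∑ M (λ i j → 𝟙 (primitive? p i j)) ≡ t * K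
    ∑∑-primitive = +-cancelʳ-≡ (P * P) _ _ (begin
      ∑∑ M π + P * P                                              ≡⟨ cong (∑∑ M π +_) ∑∑-imprimitive ⟨
      ∑∑ M π + ∑∑ M π̅                                             ≡⟨ ∑-+ M (λ i → ∑ M (π i)) (λ i → ∑ M (π̅ i)) ⟨
      ∑ M (λ i → ∑ M (π i) + ∑ M (π̅ i))                           ≡⟨ ∑-cong M (λ i → trans (sym (∑-+ M (π i) (π̅ i))) (∑-cong M (λ j → 𝟙-¬ (p ∣? i ×-dec p ∣? j)))) ⟩
      ∑∑ M (λ _ _ → 1)                                            ≡⟨ ∑-cong M (λ _ → trans (∑-const M 1) (*-identityʳ M)) ⟩
      ∑ M (λ _ → M)                                               ≡⟨ ∑-const M M ⟩
      M * M                                                       ≡⟨ cong₂ _*_ t+P≡M t+P≡M ⟨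
      (t + P) * (t + P)                                           ≡⟨ solve 2 (λ t P → (t :+ P) :* (t :+ P) := t :* ((t :+ P) :+ P) :+ P :* P) refl t P ⟩
      t * ((t + P) + P) + P * P                                   ≡⟨ cong (λ m → t * (m + P) + P * P) t+P≡M ⟩
      t * K + P * P                                               ∎)
      where
      open ≡-Reasoning
      open +-*-Solver
      π π̅ : ℕ → ℕ → ℕ
      π i j = 𝟙 (primitive? p i j)
      π̅ i j = 𝟙 (p ∣? i ×-dec p ∣? j)

    -- Where i ≡ - s j modulo M, p dividing j forces p to divide i, so primitivity means that j is a
    -- unit; each unit j then admits exactly one i.
    ∑∑-target : ∑∑ M (λ i j → 𝟙 (primitive? p i j) * target i j) ≡ t
    ∑∑-target = begin
      ∑∑ M (λ i j → 𝟙 (primitive? p i j) * target i j)      ≡⟨ ∑-comm M M (λ i j → 𝟙 (primitive? p i j) * target i j) ⟩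
      ∑∑ M (λ j i → 𝟙 (primitive? p i j) * target i j)      ≡⟨ ∑-cong M (λ j → ∑-cong M (λ i → primitive⇔∤ i j)) ⟩
      ∑∑ M (λ j i → 𝟙 (¬? (p ∣? j)) * target i j)           ≡⟨ ∑-cong M (λ j → trans (∑-*ˡ M (𝟙 (¬? (p ∣? j))) (λ i → target i j)) (trans (cong (𝟙 (¬? (p ∣? j)) *_) (column j)) (*-identityʳ (𝟙 (¬? (p ∣? j)))))) ⟩
      ∑ M (λ j → 𝟙 (¬? (p ∣? j)))                           ≡⟨ ∑-nonMultiples ⟩
      t                                                     ∎
      where
      open ≡-Reasoning
      column : ∀ j → ∑ M (λ i → target i j) ≡ 1
      column j = trans (∑-cong M (λ i → cong (λ x → 𝟙 (M ∣? x)) (+-comm i (s * j)))) (∑-∣? M (s * j))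
      primitive⇔∤ : ∀ i j → 𝟙 (primitive? p i j) * target i j ≡ 𝟙 (¬? (p ∣? j)) * target i j
      primitive⇔∤ i j with M ∣? i + s * j
      ... | no _  = trans (*-zeroʳ (𝟙 (primitive? p i j))) (sym (*-zeroʳ (𝟙 (¬? (p ∣? j)))))
      ... | yes d = cong (_* 1) (𝟙-cong (primitive? p i j) (¬? (p ∣? j))
        (λ prim p∣j → prim (∣m+n∣m⇒∣n (subst (p ∣_) (+-comm i (s * j)) (∣-trans p∣M d)) (∣n⇒∣m*n s p∣j) , p∣j))
        (_∘ proj₂))

    -- paths target n 1 1 / 2 ^ n is within e / E of 1 / K, cleared of denominators.
    equidistribution : ∀ e E .⦃ _ : NonZero e ⦄ → ∃ λ n₀ → ∀ n → n₀ ≤ n → let c = paths target n 1 1 in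
                       c * (K * E) < (E + e * K) * 2 ^ n × 2 ^ n * E < (c * E + e * 2 ^ n) * K
    equidistribution e E with ∃-power (2 ^ suc (M + M)) E (*-monoʳ-≤ 2 (m^n>0 2 (M + M)))
    ... | r , rate with oscillation pr (suc κ) target-respects (λ a b → 𝟙≤1 (M ∣? a + s * b)) r
    -- The accuracy fixes the number r of rounds; any later generation is m + r N with m = n - r N.
    ... | lo₀ , B₀ = r * N , λ n n₀≤n → subst Bounds (m∸n+n≡m n₀≤n) (bounds (n ∸ r * N))
      where
      N q : ℕ
      N = suc (M + M)
      q = pred (2 ^ N)
      instance
        K≢0 : NonZero K
        K≢0 = >-nonZero (≤-trans (>-nonZero⁻¹ M) (m≤m+n M P))
        t≢0 : NonZero t
        t≢0 = >-nonZero (m<n⇒0<n∸m (subst (P <_) (*-comm P p) (m<m*n P p (nonTrivial⇒n>1 p ⦃ prime⇒nonTrivial pr ⦄))))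
      Bounds : ℕ → Set
      Bounds n = let c = paths target n 1 1 in
                 c * (K * E) < (E + e * K) * 2 ^ n × 2 ^ n * E < (c * E + e * 2 ^ n) * K
      bounds : ∀ m → Bounds (m + r * N)
      bounds m = squeeze K E e (B 1 1 (λ (p∣1 , _) → p≢1 (∣1⇒≡1 p∣1))) average (power-bound m N r e E rate)
        where
        n lo g : ℕ
        n = m + r * N
        lo = 2 ^ m * lo₀
        g = 2 ^ m * q ^ r
        p≢1 : p ≢ 1
        p≢1 = nonTrivial⇒≢1 ⦃ prime⇒nonTrivial pr ⦄
        B : Between pr (suc κ) target-respects n lo (lo + g)
        B = subst (Between pr (suc κ) target-respects n lo) (*-distribˡ-+ (2 ^ m) lo₀ (q ^ r))
          (between-+ pr (suc κ) target-respects m B₀)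
        total≡2ⁿt : total pr (suc κ) target-respects n ≡ 2 ^ n * t
        total≡2ⁿt = trans (total≡ pr (suc κ) target-respects p∣M n) (cong (2 ^ n *_) ∑∑-target)
        factor : ∀ x → x * ∑∑ M (λ i j → 𝟙 (primitive? p i j)) ≡ x * K * t
        factor x = trans (cong (x *_) ∑∑-primitive) (trans (cong (x *_) (*-comm t K)) (sym (*-assoc x K t)))
        -- The number of primitive pairs and the number of those on the target share the factor t;
        -- cancelling it leaves 2 ^ n / K between lo and lo + g.
        average : lo * K ≤ 2 ^ n × 2 ^ n ≤ (lo + g) * K
        average with lower , upper ← total-bounds pr (suc κ) target-respects {n} B =
          *-cancelʳ-≤ _ _ t (subst₂ _≤_ (factor lo) total≡2ⁿt lower) ,
          *-cancelʳ-≤ _ _ t (subst₂ _≤_ total≡2ⁿt (factor (lo + g)) upper)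

open import Defs

-- Limits of rational sequences and arithmetic of fractions.

module Limits where
  open import Data.Integer as ℤ using (ℤ; +_; -[1+_])
  import Data.Integer.Properties as ℤ
  open import Data.Nat as ℕ using (ℕ; zero; suc; NonZero)
  import Data.Nat.Properties as ℕ
  open import Data.Nat.Primality using (Prime; prime⇒nonZero)
  open import Data.Product using (_×_; _,_; proj₁; proj₂; ∃)
  open import Data.Rational as ℚ using (ℚ; mkℚ; 1ℚ; toℚᵘ; ↥_; ↧ₙ_)
  import Data.Rational.Properties as ℚ
  open import Data.Rational.Solver using (module +-*-Solver)
  open import Data.Rational.Unnormalised as ℚᵘ using (mkℚᵘ; *<*; *≡*)
  import Data.Rational.Unnormalised.Properties as ℚᵘ
  open import Data.Sum using (inj₁; inj₂)
  open import Relation.Binary.PropositionalEquality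

  toℚᵘ-/ : ∀ i n → toℚᵘ (i ℚ./ suc n) ℚᵘ.≃ mkℚᵘ i n
  toℚᵘ-/ i n = ℚ.toℚᵘ-fromℚᵘ (mkℚᵘ i n)

  /-<-+ : ∀ a b c d .⦃ _ : NonZero b ⦄ .⦃ _ : NonZero d ⦄ {e} ε → ↥ ε ≡ + e →
          a ℕ.* (d ℕ.* ↧ₙ ε) ℕ.< (c ℕ.* ↧ₙ ε ℕ.+ e ℕ.* d) ℕ.* b → + a ℚ./ b ℚ.< (+ c ℚ./ d) ℚ.+ ε
  /-<-+ a (suc b) c (suc d) {e} ε@(mkℚ _ E _) refl h = ℚ.toℚᵘ-cancel-< (ℚᵘ.<-respˡ-≃ (ℚᵘ.≃-sym (toℚᵘ-/ (+ a) b))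
    (ℚᵘ.<-respʳ-≃ (ℚᵘ.≃-sym (ℚᵘ.≃-trans (ℚ.toℚᵘ-homo-+ (+ c ℚ./ suc d) ε) (ℚᵘ.+-congˡ (mkℚᵘ (+ e) E) (toℚᵘ-/ (+ c) d))))
      (*<* (subst₂ ℤ._<_ (ℤ.pos-* a _) rhs (ℤ.+<+ h)))))
    where
    rhs : + ((c ℕ.* suc E ℕ.+ e ℕ.* suc d) ℕ.* suc b) ≡ (+ c ℤ.* + suc E ℤ.+ + e ℤ.* + suc d) ℤ.* + suc b
    rhs = trans (ℤ.pos-* (c ℕ.* suc E ℕ.+ e ℕ.* suc d) (suc b))
      (cong (ℤ._* + suc b) (trans (ℤ.pos-+ (c ℕ.* suc E) (e ℕ.* suc d)) (cong₂ ℤ._+_ (ℤ.pos-* c (suc E)) (ℤ.pos-* e (suc d)))))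

  ∣-∣-< : ∀ {x y ε} → x ℚ.< y ℚ.+ ε → y ℚ.< x ℚ.+ ε → ℚ.∣ x ℚ.- y ∣ ℚ.< ε
  ∣-∣-< {x} {y} {ε} x<y+ε y<x+ε with ℚ.∣p∣≡p∨∣p∣≡-p (x ℚ.- y)
  ... | inj₁ eq = subst₂ ℚ._<_ (sym eq) (solve 2 (λ y e → (y :+ e) :- y := e) refl y ε) (ℚ.+-monoˡ-< (ℚ.- y) x<y+ε)
    where open +-*-Solver
  ... | inj₂ eq = subst₂ ℚ._<_ (trans (solve 2 (λ x y → y :- x := :- (x :- y)) refl x y) (sym eq))
    (solve 2 (λ x e → (x :+ e) :- x := e) refl x ε) (ℚ.+-monoˡ-< (ℚ.- x) y<x+ε)
    where open +-*-Solver

  /2^⟶1/ : ∀ (c : ℕ → ℕ) K .⦃ _ : NonZero K ⦄ →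
           (∀ e E .⦃ _ : NonZero e ⦄ → ∃ λ n₀ → ∀ n → n₀ ℕ.≤ n →
             c n ℕ.* (K ℕ.* E) ℕ.< (E ℕ.+ e ℕ.* K) ℕ.* 2 ℕ.^ n ×
             2 ℕ.^ n ℕ.* E ℕ.< (c n ℕ.* E ℕ.+ e ℕ.* 2 ℕ.^ n) ℕ.* K) →
           (λ n → (+ c n ℚ./ 2 ℕ.^ n) ⦃ ℕ.m^n≢0 2 n ⦄) ⟶ + 1 ℚ./ K
  /2^⟶1/ c K ⦃ K≢0 ⦄ close (mkℚ (+ zero)    _ _) (ℚ.*<* (ℤ.+<+ ()))
  /2^⟶1/ c K ⦃ K≢0 ⦄ close (mkℚ -[1+ _ ]    _ _) (ℚ.*<* ())
  /2^⟶1/ c K ⦃ K≢0 ⦄ close ε@(mkℚ (+ suc e) E _) _ with n₀ , h ← close (suc e) (suc E) = n₀ , λ n n₀≤n → ∣-∣-<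
    (/-<-+ (c n) (2 ℕ.^ n) 1 K ⦃ ℕ.m^n≢0 2 n ⦄ ε refl
      (subst (λ x → c n ℕ.* (K ℕ.* suc E) ℕ.< (x ℕ.+ suc e ℕ.* K) ℕ.* 2 ℕ.^ n) (sym (ℕ.*-identityˡ (suc E))) (proj₁ (h n n₀≤n))))
    (/-<-+ 1 K (c n) (2 ℕ.^ n) ⦃ K≢0 ⦄ ⦃ ℕ.m^n≢0 2 n ⦄ ε refl
      (subst (ℕ._< (c n ℕ.* suc E ℕ.+ suc e ℕ.* 2 ℕ.^ n) ℕ.* K) (sym (ℕ.*-identityˡ _)) (proj₂ (h n n₀≤n))))

  ⟶-cong : ∀ {u v l} → v ⟶ l → (∀ n → u n ≡ v n) → u ⟶ l
  ⟶-cong {l = l} v⟶l u≡v ε ε>0 with N , h ← v⟶l ε ε>0 =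
    N , λ n N≤n → subst (λ x → ℚ.∣ x ℚ.- l ∣ ℚ.< ε) (sym (u≡v n)) (h n N≤n)

  -- Generation n + 1 consists of 2 ^ n fractions, so `F` at `suc n` is to be compared with a
  -- density at n.
  ⟶-suc : ∀ {u v l} → v ⟶ l → (∀ n → u (suc n) ≡ v n) → u ⟶ l
  ⟶-suc {u} {v} {l} v⟶l u≡v ε ε>0 with N , h ← v⟶l ε ε>0 = suc N , λ where
    (suc n) (ℕ.s≤s N≤n) → subst (λ x → ℚ.∣ x ℚ.- l ∣ ℚ.< ε) (sym (u≡v n)) (h n N≤n)

  ⟶-complement : ∀ {u l} → u ⟶ l → (λ n → 1ℚ ℚ.- u n) ⟶ 1ℚ ℚ.- l
  ⟶-complement {u} {l} u⟶l ε ε>0 with N , h ← u⟶l ε ε>0 = N , λ n N≤n →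
    subst (ℚ._< ε) (trans (sym (ℚ.∣-p∣≡∣p∣ (u n ℚ.- l))) (cong ℚ.∣_∣ (lemma (u n)))) (h n N≤n)
    where
    open +-*-Solver
    lemma : ∀ x → ℚ.- (x ℚ.- l) ≡ (1ℚ ℚ.- x) ℚ.- (1ℚ ℚ.- l)
    lemma x = solve 3 (λ o x l → :- (x :- l) := (o :- x) :- (o :- l)) refl 1ℚ x l

  /-complement : ∀ {m n} d .⦃ _ : NonZero d ⦄ → m ℕ.+ n ≡ d → + m ℚ./ d ≡ 1ℚ ℚ.- (+ n ℚ./ d)
  /-complement {m} {n} (suc d) m+n≡d = begin
    x                        ≡⟨ solve 2 (λ x y → x := (x :+ y) :- y) refl x y ⟩
    (x ℚ.+ y) ℚ.- y          ≡⟨ cong (ℚ._- y) x+y≡1 ⟩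
    1ℚ ℚ.- y                 ∎
    where
    open +-*-Solver
    open ≡-Reasoning
    x y : ℚ
    x = + m ℚ./ suc d
    y = + n ℚ./ suc d
    x+y≡1 : x ℚ.+ y ≡ 1ℚ
    x+y≡1 = ℚ.toℚᵘ-injective (ℚᵘ.≃-trans (ℚ.toℚᵘ-homo-+ x y)
      (ℚᵘ.≃-trans (ℚᵘ.+-cong (toℚᵘ-/ (+ m) d) (toℚᵘ-/ (+ n) d)) (*≡* (begin
        (+ m ℤ.* + suc d ℤ.+ + n ℤ.* + suc d) ℤ.* + 1    ≡⟨ ℤ.*-identityʳ _ ⟩
        + m ℤ.* + suc d ℤ.+ + n ℤ.* + suc d              ≡⟨ ℤ.*-distribʳ-+ (+ suc d) (+ m) (+ n) ⟨
        + (m ℕ.+ n) ℤ.* + suc d                          ≡⟨ cong (λ k → + k ℤ.* + suc d) m+n≡d ⟩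
        + suc d ℤ.* + suc d                              ≡⟨ ℤ.*-identityˡ _ ⟨
        + 1 ℤ.* (+ suc d ℤ.* + suc d)                    ∎))))

  1/2^*/1 : ∀ c n → (+ 1 ℚ./ 2 ℕ.^ n) ⦃ ℕ.m^n≢0 2 n ⦄ ℚ.* (+ c ℚ./ 1) ≡ (+ c ℚ./ 2 ℕ.^ n) ⦃ ℕ.m^n≢0 2 n ⦄
  1/2^*/1 c n = lemma (2 ℕ.^ n) ⦃ ℕ.m^n≢0 2 n ⦄
    where
    lemma : ∀ d .⦃ _ : NonZero d ⦄ → (+ 1 ℚ./ d) ℚ.* (+ c ℚ./ 1) ≡ + c ℚ./ d
    lemma (suc d) = ℚ.toℚᵘ-injective (ℚᵘ.≃-trans (ℚ.toℚᵘ-homo-* (+ 1 ℚ./ suc d) (+ c ℚ./ 1))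
      (ℚᵘ.≃-trans (ℚᵘ.*-cong (toℚᵘ-/ (+ 1) d) (toℚᵘ-/ (+ c) 0))
        (ℚᵘ.≃-trans (*≡* (cong₂ ℤ._*_ (ℤ.*-identityˡ (+ c)) (cong (λ x → + suc x) (sym (ℕ.*-identityʳ d)))))
          (ℚᵘ.≃-sym (toℚᵘ-/ (+ c) d)))))

  2^-[1+n]+1 : ∀ n → 2 ^ (ℤ.- + suc n ℤ.+ ℤ.1ℤ) ≡ (+ 1 ℚ./ 2 ℕ.^ n) ⦃ ℕ.m^n≢0 2 n ⦄
  2^-[1+n]+1 zero    = refl
  2^-[1+n]+1 (suc n) = refl

  2^-[1+n]+1*/1 : ∀ n {c c′} → c ≡ c′ → 2 ^ (ℤ.- + suc n ℤ.+ ℤ.1ℤ) ℚ.* (+ c ℚ./ 1) ≡ (+ c′ ℚ./ 2 ℕ.^ n) ⦃ ℕ.m^n≢0 2 n ⦄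
  2^-[1+n]+1*/1 n {c} refl = trans (cong (ℚ._* (+ c ℚ./ 1)) (2^-[1+n]+1 n)) (1/2^*/1 c n)

  1/-unique : ∀ x .⦃ _ : ℚ.NonZero x ⦄ {y} → x ℚ.* y ≡ 1ℚ → ℚ.1/ x ≡ y
  1/-unique x {y} xy≡1 = begin
    ℚ.1/ x                   ≡⟨ ℚ.*-identityʳ (ℚ.1/ x) ⟨
    ℚ.1/ x ℚ.* 1ℚ            ≡⟨ cong (ℚ.1/ x ℚ.*_) xy≡1 ⟨
    ℚ.1/ x ℚ.* (x ℚ.* y)     ≡⟨ ℚ.*-assoc (ℚ.1/ x) x y ⟨
    ℚ.1/ x ℚ.* x ℚ.* y       ≡⟨ cong (ℚ._* y) (ℚ.*-inverseˡ x) ⟩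
    1ℚ ℚ.* y                 ≡⟨ ℚ.*-identityˡ y ⟩
    y                        ∎
    where open ≡-Reasoning

  [m+n]*1/ : ∀ m n .⦃ _ : NonZero (m ℕ.+ n) ⦄ → ((+ m ℚ./ 1) ℚ.+ (+ n ℚ./ 1)) ℚ.* (+ 1 ℚ./ (m ℕ.+ n)) ≡ 1ℚ
  [m+n]*1/ m n = lemma (m ℕ.+ n) refl
    where
    lemma : ∀ k .⦃ _ : NonZero k ⦄ → m ℕ.+ n ≡ k → ((+ m ℚ./ 1) ℚ.+ (+ n ℚ./ 1)) ℚ.* (+ 1 ℚ./ k) ≡ 1ℚ
    lemma (suc k) eq = ℚ.toℚᵘ-injective (ℚᵘ.≃-trans (ℚ.toℚᵘ-homo-* ((+ m ℚ./ 1) ℚ.+ (+ n ℚ./ 1)) (+ 1 ℚ./ suc k))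
      (ℚᵘ.≃-trans (ℚᵘ.*-cong (ℚᵘ.≃-trans (ℚ.toℚᵘ-homo-+ (+ m ℚ./ 1) (+ n ℚ./ 1)) (ℚᵘ.+-cong (toℚᵘ-/ (+ m) 0) (toℚᵘ-/ (+ n) 0)))
        (toℚᵘ-/ (+ 1) k)) (*≡* eqℤ)))
      where
      open ≡-Reasoning
      eqℤ : (+ m ℤ.* + 1 ℤ.+ + n ℤ.* + 1) ℤ.* + 1 ℤ.* + 1 ≡ + 1 ℤ.* (+ suc (k ℕ.+ 0))
      eqℤ = begin
        (+ m ℤ.* + 1 ℤ.+ + n ℤ.* + 1) ℤ.* + 1 ℤ.* + 1   ≡⟨ trans (ℤ.*-identityʳ _) (ℤ.*-identityʳ _) ⟩
        + m ℤ.* + 1 ℤ.+ + n ℤ.* + 1                       ≡⟨ cong₂ ℤ._+_ (ℤ.*-identityʳ (+ m)) (ℤ.*-identityʳ (+ n)) ⟩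
        + (m ℕ.+ n)                                       ≡⟨ cong +_ eq ⟩
        + suc k                                           ≡⟨ cong (λ x → + suc x) (ℕ.+-identityʳ k) ⟨
        + suc (k ℕ.+ 0)                                   ≡⟨ ℤ.*-identityˡ _ ⟨
        + 1 ℤ.* (+ suc (k ℕ.+ 0))                         ∎

  1/[^+^]≡ : ∀ p ⦃ pr : Prime p ⦄ {i j : ℤ} {m n} → i ≡ + m → j ≡ + n → .⦃ _ : NonZero (p ℕ.^ m ℕ.+ p ℕ.^ n) ⦄ →
             1/[ p ^ i +^ j ] ≡ + 1 ℚ./ (p ℕ.^ m ℕ.+ p ℕ.^ n)
  1/[^+^]≡ p ⦃ pr ⦄ {m = m} {n} refl refl = 1/-unique (p ^ + m ℚ.+ p ^ + n)
    ⦃ ℚ.pos⇒nonZero (p ^ + m ℚ.+ p ^ + n) ⦃ ℚ.pos+pos⇒pos (p ^ + m) ⦃ ^-positive p (+ m) ⦄ (p ^ + n) ⦃ ^-positive p (+ n) ⦄ ⦄ ⦄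
    ([m+n]*1/ (p ℕ.^ m) (p ℕ.^ n))
    where
    instance
      p≢0 : NonZero p
      p≢0 = prime⇒nonZero pr

-- p-adic valuations as divisibility of linear forms.

module Valuations where
  open import Data.Integer as ℤ using (ℤ; +_; -[1+_])
  import Data.Integer.Divisibility.Signed as ℤ∣
  open import Data.Integer.DivMod using (_%ℕ_; _/ℕ_; a≡a%ℕn+[a/ℕn]*n)
  import Data.Integer.Properties as ℤ
  open import Data.Integer.Solver using (module +-*-Solver)
  open import Data.Nat as ℕ using (ℕ; suc; NonZero)
  import Data.Nat.Properties as ℕ
  open import Data.Nat.Coprimality as Coprimality using (Coprime; coprime-Bézout; coprime-divisor)
  open import Data.Nat.Divisibility using (_∣_; ∣-trans; m∣m*n; ∣n⇒∣m*n; 1∣_)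
  open import Data.Nat.GCD using (module Bézout)
  open import Data.Nat.Primality using (Prime; prime⇒nonTrivial)
  open import Data.Product using (_×_; _,_; proj₁; proj₂; ∃; ∃₂)
  open import Data.Rational as ℚ using (ℚ; mkℚ; ↥_; ↧_; ↧ₙ_)
  import Data.Rational.Properties as ℚ
  open import Data.Rational.Unnormalised as ℚᵘ using (mkℚᵘ; *≡*)
  import Data.Rational.Unnormalised.Properties as ℚᵘ
  open import Function using (_⇔_; mk⇔; _∘_; Equivalence)
  open import Relation.Binary.PropositionalEquality
  open import Relation.Binary.Construct.Add.Supremum.NonStrict ℤ._≤_ using (_≤⁺_; [_]; ≤⁺-trans)
  open import Relation.Nullary using (¬_)
  open import Relation.Nullary.Construct.Add.Supremum using ([_])
  open Walk using (Primitive; ∤⇒coprime)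

  -- Signed divisibility handles sums and natural-number divisibility handles coprime factors;
  -- products pass between them in both directions.
  ∣-∣-∣* : ∀ {d} a b → (+ d ℤ∣.∣ a ℤ.* b → d ∣ ℤ.∣ a ∣ ℕ.* ℤ.∣ b ∣) × (d ∣ ℤ.∣ a ∣ ℕ.* ℤ.∣ b ∣ → + d ℤ∣.∣ a ℤ.* b)
  ∣-∣-∣* {d} a b = subst (d ∣_) (ℤ.abs-* a b) ∘ ℤ∣.∣⇒∣ᵤ , ℤ∣.∣ᵤ⇒∣ ∘ subst (d ∣_) (sym (ℤ.abs-* a b))

  ^∣-cancelˡ : ∀ {p} → Prime p → ∀ k {c x} → ¬ (p ∣ c) → p ℕ.^ k ∣ c ℕ.* x → p ℕ.^ k ∣ x
  ^∣-cancelˡ pr k p∤c = coprime-divisor (Coprimality.sym (∤⇒coprime pr p∤c k))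

  ℤ-inverse : ∀ x {M} → Coprime ℤ.∣ x ∣ M → ∃₂ λ e k → e ℤ.* x ≡ + 1 ℤ.+ k ℤ.* + M
  ℤ-inverse (+ n) {M} n⊥M with coprime-Bézout n⊥M
  ... | Bézout.+- t y eq = + t , + y , (begin
    + t ℤ.* + n            ≡⟨ ℤ.pos-* t n ⟨
    + (t ℕ.* n)            ≡⟨ cong +_ eq ⟨
    + (1 ℕ.+ y ℕ.* M)      ≡⟨ cong (ℤ._+_ (+ 1)) (ℤ.pos-* y M) ⟩
    + 1 ℤ.+ + y ℤ.* + M    ∎)
    where open ≡-Reasoning
  ... | Bézout.-+ t y eq = ℤ.- + t , ℤ.- + y , (begin
    ℤ.- + t ℤ.* + n                    ≡⟨ solve 2 (λ t n → :- t :* n := con (+ 1) :- (con (+ 1) :+ t :* n)) refl (+ t) (+ n) ⟩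
    + 1 ℤ.- (+ 1 ℤ.+ + t ℤ.* + n)      ≡⟨ cong (λ x → + 1 ℤ.- (+ 1 ℤ.+ x)) (ℤ.pos-* t n) ⟨
    + 1 ℤ.- + (1 ℕ.+ t ℕ.* n)          ≡⟨ cong (λ x → + 1 ℤ.- + x) eq ⟩
    + 1 ℤ.- + (y ℕ.* M)                ≡⟨ cong (ℤ._-_ (+ 1)) (ℤ.pos-* y M) ⟩
    + 1 ℤ.- + y ℤ.* + M                ≡⟨ solve 2 (λ y M → con (+ 1) :- y :* M := con (+ 1) :+ :- y :* M) refl (+ y) (+ M) ⟩
    + 1 ℤ.+ ℤ.- + y ℤ.* + M            ∎)
    where
    open +-*-Solver
    open ≡-Reasoning
  ℤ-inverse -[1+ n ] {M} n⊥M with e , k , eq ← ℤ-inverse (+ suc n) {M} n⊥M =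
    ℤ.- e , k , trans (solve 2 (λ e x → :- e :* :- x := e :* x) refl e (+ suc n)) eq
    where open +-*-Solver

  -- With e inverse to x modulo M and s = e y mod M, the form x a + y b agrees with x (a + s b)
  -- modulo M, and the unit x does not affect divisibility.
  normal-form : ∀ x y M .⦃ _ : NonZero M ⦄ → Coprime ℤ.∣ x ∣ M →
                ∃ λ s → ∀ a b → M ∣ ℤ.∣ x ℤ.* + a ℤ.+ y ℤ.* + b ∣ ⇔ M ∣ a ℕ.+ s ℕ.* b
  normal-form x y M x⊥M with e , k , ex≡1+kM ← ℤ-inverse x {M} x⊥M = s , λ a b → mk⇔
    (λ h → coprime-divisor (Coprimality.sym x⊥M) (proj₁ (∣-∣-∣* x (+ (a ℕ.+ s ℕ.* b)))
      (subst (+ M ℤ∣.∣_) (sym (key a b)) (ℤ∣.∣m∣n⇒∣m+n (ℤ∣.∣ᵤ⇒∣ {i = form a b} h) (M∣l b)))))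
    (λ h → ℤ∣.∣⇒∣ᵤ (ℤ∣.∣m+n∣n⇒∣m {+ M} {form a b} (subst (+ M ℤ∣.∣_) (key a b)
      (proj₂ (∣-∣-∣* x (+ (a ℕ.+ s ℕ.* b))) (∣n⇒∣m*n ℤ.∣ x ∣ h))) (M∣l b)))
    where
    s : ℕ
    s = (e ℤ.* y) %ℕ M
    -- h is the quotient lost in reducing e y modulo M; l combines it with the k of e x = 1 + k M,
    -- so that x s = y + l M.
    h l : ℤ
    h = (e ℤ.* y) /ℕ M
    l = y ℤ.* k ℤ.- x ℤ.* h
    form : ℕ → ℕ → ℤ
    form a b = x ℤ.* + a ℤ.+ y ℤ.* + b
    M∣l : ∀ b → + M ℤ∣.∣ l ℤ.* + b ℤ.* + M
    M∣l b = ℤ∣.∣n⇒∣m*n (l ℤ.* + b) ℤ∣.∣-refl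
    open +-*-Solver
    open ≡-Reasoning
    xs≡y+lM : x ℤ.* + s ≡ y ℤ.+ l ℤ.* + M
    xs≡y+lM = begin
      x ℤ.* + s                                             ≡⟨ solve 4 (λ x s h M → x :* s := x :* (s :+ h :* M) :- x :* h :* M) refl x (+ s) h (+ M) ⟩
      x ℤ.* (+ s ℤ.+ h ℤ.* + M) ℤ.- x ℤ.* h ℤ.* + M         ≡⟨ cong (λ w → x ℤ.* w ℤ.- x ℤ.* h ℤ.* + M) (a≡a%ℕn+[a/ℕn]*n (e ℤ.* y) M) ⟨
      x ℤ.* (e ℤ.* y) ℤ.- x ℤ.* h ℤ.* + M                   ≡⟨ solve 5 (λ x e y h M → x :* (e :* y) :- x :* h :* M := e :* x :* y :- x :* h :* M) refl x e y h (+ M) ⟩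
      e ℤ.* x ℤ.* y ℤ.- x ℤ.* h ℤ.* + M                     ≡⟨ cong (λ w → w ℤ.* y ℤ.- x ℤ.* h ℤ.* + M) ex≡1+kM ⟩
      (+ 1 ℤ.+ k ℤ.* + M) ℤ.* y ℤ.- x ℤ.* h ℤ.* + M         ≡⟨ solve 5 (λ k M y x h → (con (+ 1) :+ k :* M) :* y :- x :* h :* M := y :+ (y :* k :- x :* h) :* M) refl k (+ M) y x h ⟩
      y ℤ.+ l ℤ.* + M                                       ∎
    key : ∀ a b → x ℤ.* + (a ℕ.+ s ℕ.* b) ≡ form a b ℤ.+ l ℤ.* + b ℤ.* + M
    key a b = begin
      x ℤ.* + (a ℕ.+ s ℕ.* b)                    ≡⟨ cong (λ w → x ℤ.* (+ a ℤ.+ w)) (ℤ.pos-* s b) ⟩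
      x ℤ.* (+ a ℤ.+ + s ℤ.* + b)                ≡⟨ solve 4 (λ x a s b → x :* (a :+ s :* b) := x :* a :+ x :* s :* b) refl x (+ a) (+ s) (+ b) ⟩
      x ℤ.* + a ℤ.+ x ℤ.* + s ℤ.* + b            ≡⟨ cong (λ w → x ℤ.* + a ℤ.+ w ℤ.* + b) xs≡y+lM ⟩
      x ℤ.* + a ℤ.+ (y ℤ.+ l ℤ.* + M) ℤ.* + b    ≡⟨ solve 6 (λ x a y l M b → x :* a :+ (y :+ l :* M) :* b := x :* a :+ y :* b :+ l :* b :* M) refl x (+ a) y l (+ M) (+ b) ⟩
      form a b ℤ.+ l ℤ.* + b ℤ.* + M             ∎

  module _ {p} ⦃ pr : Prime p ⦄ where
    private
      instance
        nt : ℕ.NonTrivial p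
        nt = prime⇒nonTrivial pr

    -- `ord` is computed from lowest terms, whereas a / d may be any representation of q; passing
    -- from q to a adds the valuation of d.
    ord-≥⇔ : ∀ ν a d .⦃ _ : NonZero d ⦄ q → ↥ q ℤ.* + d ≡ a ℤ.* ↧ q →
             [ ν ] ≤⁺ ord p q ⇔ [ ν ℤ.+ + ordℕ p d ] ≤⁺ ordℤ p a
    ord-≥⇔ ν a d q eq = mk⇔
      (subst ([ ν ℤ.+ + ordℕ p d ] ≤⁺_) (sym (ord-/ p a d q eq)) ∘ ≤-map-+ (+ ordℕ p d))
      (≤-map-+⁻¹ (+ ordℕ p d) ∘ subst ([ ν ℤ.+ + ordℕ p d ] ≤⁺_) (ord-/ p a d q eq))

    value≡ : ∀ a b .⦃ _ : NonZero b ⦄ → ↥ (+ a ℚ./ b) ℤ.* + b ≡ + a ℤ.* ↧ (+ a ℚ./ b)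
    value≡ a (suc b) with *≡* h ← ℚ.toℚᵘ-fromℚᵘ (mkℚᵘ (+ a) b) =
      trans (cong (ℤ._* + suc b) (sym (ℚ.↥ᵘ-toℚᵘ (+ a ℚ./ suc b)))) (trans h (cong (ℤ._*_ (+ a)) (ℚ.↧ᵘ-toℚᵘ (+ a ℚ./ suc b))))

    value-≡ : ∀ a b .⦃ _ : NonZero b ⦄ q → let x = (+ a ℚ./ b) ℚ.- q in
              ↥ x ℤ.* + (b ℕ.* ↧ₙ q) ≡ (+ a ℤ.* ↧ q ℤ.- ↥ q ℤ.* + b) ℤ.* ↧ x
    value-≡ a (suc b) q@(mkℚ u w-1 _)
      with *≡* h ← ℚᵘ.≃-trans (ℚ.toℚᵘ-homo-+ (+ a ℚ./ suc b) (ℚ.- q))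
             (ℚᵘ.+-cong (ℚ.toℚᵘ-fromℚᵘ (mkℚᵘ (+ a) b)) (ℚ.toℚᵘ-homo‿- q)) =
      trans (cong (ℤ._* + (suc b ℕ.* suc w-1)) (sym (ℚ.↥ᵘ-toℚᵘ x)))
        (trans h (cong₂ ℤ._*_ (cong (ℤ._+_ (+ a ℤ.* + suc w-1)) (sym (ℤ.neg-distribˡ-* u (+ suc b)))) (ℚ.↧ᵘ-toℚᵘ x)))
      where
      x = (+ a ℚ./ suc b) ℚ.- q

    <-ordℕ⇒^∣ : ∀ {k} n .⦃ _ : NonZero n ⦄ → k ℕ.< ordℕ p n → p ℕ.^ suc k ∣ n × p ∣ n
    <-ordℕ⇒^∣ {k} n k<v = ≤ordℕ⇒^∣ p (suc k) n k<v , ∣-trans (m∣m*n (p ℕ.^ k)) (≤ordℕ⇒^∣ p (suc k) n k<v)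

    -- Either side forces b and w to have the same valuation, since one of a and b is prime to p,
    -- and so is one of u and w.
    ord-value--≥⇔ : ∀ m .⦃ _ : NonZero m ⦄ a b .⦃ _ : NonZero b ⦄ → Primitive p a b → ∀ q →
      [ + m ℤ.- + ordℕ p (↧ₙ q) ] ≤⁺ ord p ((+ a ℚ./ b) ℚ.- q) ⇔
      p ℕ.^ (m ℕ.+ ordℕ p (↧ₙ q)) ∣ ℤ.∣ + a ℤ.* ↧ q ℤ.- ↥ q ℤ.* + b ∣
    ord-value--≥⇔ m a b prim q@(mkℚ u w-1 cop) = mk⇔
      (λ h → to (≤ordℤ⇒^∣ p (m ℕ.+ β) A (subst (λ i → [ i ] ≤⁺ ordℤ p A) ν+≡ (Equivalence.to equiv h))))
      (λ h → Equivalence.from equiv (subst (λ i → [ i ] ≤⁺ ordℤ p A) (sym ν+≡) (^∣⇒≤ordℤ p (m ℕ.+ β) A (from h))))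
      where
      w β ω : ℕ
      w = suc w-1
      β = ordℕ p b
      ω = ordℕ p w
      A : ℤ
      A = + a ℤ.* + w ℤ.- u ℤ.* + b
      instance
        bw≢0 : NonZero (b ℕ.* w)
        bw≢0 = ℕ.m*n≢0 b w
      equiv = ord-≥⇔ (+ m ℤ.- + ω) A (b ℕ.* w) ((+ a ℚ./ b) ℚ.- q) (value-≡ a b q)
      ν+≡ : + m ℤ.- + ω ℤ.+ + ordℕ p (b ℕ.* w) ≡ + (m ℕ.+ β)
      ν+≡ = trans (cong (λ v → + m ℤ.- + ω ℤ.+ + v) (ordℕ-* p b w))
        (solve 3 (λ m v w → m :- w :+ (v :+ w) := m :+ v) refl (+ m) (+ β) (+ ω))
        where open +-*-Solver
      aw⇒ub : ∀ {d} → d ∣ ℤ.∣ A ∣ → d ∣ a ℕ.* w → d ∣ ℤ.∣ u ∣ ℕ.* b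
      aw⇒ub {d} d∣A d∣aw = proj₁ (∣-∣-∣* u (+ b)) (subst (+ d ℤ∣.∣_)
        (solve 2 (λ x y → x :- (x :- y) := y) refl (+ a ℤ.* + w) (u ℤ.* + b))
        (ℤ∣.∣m∣n⇒∣m-n (proj₂ (∣-∣-∣* (+ a) (+ w)) d∣aw) (ℤ∣.∣ᵤ⇒∣ {i = A} d∣A)))
        where open +-*-Solver
      ub⇒aw : ∀ {d} → d ∣ ℤ.∣ A ∣ → d ∣ ℤ.∣ u ∣ ℕ.* b → d ∣ a ℕ.* w
      ub⇒aw {d} d∣A d∣ub = proj₁ (∣-∣-∣* (+ a) (+ w)) (subst (+ d ℤ∣.∣_)
        (solve 2 (λ x y → (x :- y) :+ y := x) refl (+ a ℤ.* + w) (u ℤ.* + b))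
        (ℤ∣.∣m∣n⇒∣m+n (ℤ∣.∣ᵤ⇒∣ {i = A} d∣A) (proj₂ (∣-∣-∣* u (+ b)) d∣ub)))
        where open +-*-Solver
      to : p ℕ.^ (m ℕ.+ β) ∣ ℤ.∣ A ∣ → p ℕ.^ (m ℕ.+ ω) ∣ ℤ.∣ A ∣
      to h = ∣-trans (^-∣ p (ℕ.+-monoʳ-≤ m (ℕ.≮⇒≥ β≮ω))) h
        where
        β≮ω : ¬ (β ℕ.< ω)
        -- If β < ω, then p divides w and hence not u. Now p ^ (β + 1) divides a w, and it divides A
        -- because m ≥ 1. So it divides u b, and therefore b, which has valuation only β.
        β≮ω β<ω with <-ordℕ⇒^∣ w β<ω
        ... | p^∣w , p∣w = ℕ.<-irrefl refl (^∣⇒≤ordℕ p (suc β) b (^∣-cancelˡ pr (suc β) p∤u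
          (aw⇒ub (∣-trans (^-∣ p (ℕ.+-monoˡ-≤ β (ℕ.>-nonZero⁻¹ m))) h) (∣n⇒∣m*n a p^∣w))))
          where
          p∤u : ¬ (p ∣ ℤ.∣ u ∣)
          p∤u p∣u = ℕ.nonTrivial⇒≢1 {p} (Coprimality.recompute cop (p∣u , p∣w))
      from : p ℕ.^ (m ℕ.+ ω) ∣ ℤ.∣ A ∣ → p ℕ.^ (m ℕ.+ β) ∣ ℤ.∣ A ∣
      from h = ∣-trans (^-∣ p (ℕ.+-monoʳ-≤ m (ℕ.≮⇒≥ ω≮β))) h
        where
        ω≮β : ¬ (ω ℕ.< β)
        -- Symmetrically, ω < β would make p divide b and not a, so that p ^ (ω + 1) would divide a
        -- w and then w.
        ω≮β ω<β with <-ordℕ⇒^∣ b ω<β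
        ... | p^∣b , p∣b = ℕ.<-irrefl refl (^∣⇒≤ordℕ p (suc ω) w (^∣-cancelˡ pr (suc ω) (λ p∣a → prim (p∣a , p∣b))
          (ub⇒aw (∣-trans (^-∣ p (ℕ.+-monoˡ-≤ ω (ℕ.>-nonZero⁻¹ m))) h) (∣n⇒∣m*n ℤ.∣ u ∣ p^∣b))))

    -- If p ^ (n + 1) divides b, then p does not divide a, and the valuation of a / b is below - n.
    -- Otherwise b has valuation at most n, and that of a is never negative.
    ord-value-≥⇔ : ∀ n a b .⦃ _ : NonZero b ⦄ → Primitive p a b →
      [ ℤ.- + n ] ≤⁺ ord p (+ a ℚ./ b) ⇔ (¬ (p ℕ.^ suc n ∣ b))
    ord-value-≥⇔ n a b prim = mk⇔ to from
      where
      β : ℕ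
      β = ordℕ p b
      equiv = ord-≥⇔ (ℤ.- + n) (+ a) b (+ a ℚ./ b) (value≡ a b)
      cancel : ∀ k → ℤ.- + n ℤ.+ (+ k ℤ.+ + n) ≡ + k
      cancel k = solve 2 (λ n k → :- n :+ (k :+ n) := k) refl (+ n) (+ k)
        where open +-*-Solver
      to : [ ℤ.- + n ] ≤⁺ ord p (+ a ℚ./ b) → ¬ (p ℕ.^ suc n ∣ b)
      to h p^∣b = prim (subst (_∣ a) (ℕ.*-identityʳ p) (≤ordℤ⇒^∣ p 1 (+ a)
        (≤⁺-trans ℤ.≤-trans [ subst (ℤ._≤ ℤ.- + n ℤ.+ + β) (cancel 1) (ℤ.+-monoʳ-≤ (ℤ.- + n) (ℤ.+≤+ (^∣⇒≤ordℕ p (suc n) b p^∣b))) ]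
          (Equivalence.to equiv h))) , ∣-trans (m∣m*n (p ℕ.^ n)) p^∣b)
      from : ¬ (p ℕ.^ suc n ∣ b) → [ ℤ.- + n ] ≤⁺ ord p (+ a ℚ./ b)
      from p^∤b = Equivalence.from equiv (≤⁺-trans ℤ.≤-trans
        [ subst (ℤ.- + n ℤ.+ + β ℤ.≤_) (cancel 0) (ℤ.+-monoʳ-≤ (ℤ.- + n) (ℤ.+≤+ β≤n)) ]
        (^∣⇒≤ordℤ p 0 (+ a) (1∣ a)))
        where
        β≤n : β ℕ.≤ n
        β≤n = ℕ.≮⇒≥ (p^∤b ∘ ≤ordℕ⇒^∣ p (suc n) b)

-- Counting in the tree, and the three limits.

module Counting where
  open import Data.Integer as ℤ using (ℤ; +_; -[1+_])
  import Data.Integer.Properties as ℤ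
  import Data.Integer.Solver as ℤ
  import Data.Maybe as Maybe
  open import Data.List using (List; []; _∷_; map; filter; length; concatMap)
  open import Data.List.Relation.Unary.All as All using (All; []; _∷_)
  open import Data.Nat as ℕ using (ℕ; zero; suc; NonZero)
  import Data.Nat.Properties as ℕ
  import Data.Nat.Solver as ℕ
  import Data.Nat.Coprimality as Coprimality
  open import Data.Nat.Divisibility using (_∣_; _∣?_; ∣-trans; m∣m*n; ∣1⇒≡1; 1∣_)
  open import Data.Nat.ListAction using (sum)
  open import Data.Nat.Primality using (Prime; prime⇒nonZero; prime⇒nonTrivial)
  open import Data.Product using (_×_; _,_; proj₁; proj₂; ∃)
  open import Data.Rational as ℚ using (ℚ; mkℚ; 1ℚ; ↥_; ↧_; ↧ₙ_)
  import Data.Rational.Properties as ℚ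
  import Data.Rational.Solver as ℚ
  open import Data.Sum using (_⊎_; inj₁; inj₂)
  open import Function using (case_of_; _⇔_; mk⇔; _∘_; Equivalence)
  open import Relation.Binary.Construct.Add.Supremum.NonStrict ℤ._≤_ using (_≤⁺_; [_]; ≤⁺-trans)
  open import Relation.Binary.PropositionalEquality hiding ([_])
  open import Relation.Nullary using (¬_; Dec; yes; no; contradiction; ¬?)
  open import Relation.Nullary.Construct.Add.Supremum using ([_])
  open Sums using (𝟙; 𝟙-cong; 𝟙-¬)
  open Walk using (paths; paths-flip; Primitive; left-primitive; right-primitive; ∤⇒coprime)
  open Equidistribution
  open Limits
  open Valuations

  paths-complement : ∀ f g → (∀ a b → f a b ℕ.+ g a b ≡ 1) → ∀ n a b → paths f n a b ℕ.+ paths g n a b ≡ 2 ℕ.^ n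
  paths-complement f g f+g≡1 zero    a b = f+g≡1 a b
  paths-complement f g f+g≡1 (suc n) a b = trans
    (solve 4 (λ x y z w → (x :+ y) :+ (z :+ w) := (x :+ z) :+ (y :+ w)) refl
      (paths f n a (a ℕ.+ b)) (paths f n (a ℕ.+ b) b) (paths g n a (a ℕ.+ b)) (paths g n (a ℕ.+ b) b))
    (cong₂ ℕ._+_ (paths-complement f g f+g≡1 n a (a ℕ.+ b))
      (trans (paths-complement f g f+g≡1 n (a ℕ.+ b) b) (sym (ℕ.+-identityʳ _))))
    where open ℕ.+-*-Solver

  sumOver : (ℕ → ℕ → ℕ) → List Fraction → ℕ
  sumOver f xs = sum (map (λ x → f (num x) (den x)) xs)

  sumOver-children : ∀ f n xs → sumOver (paths f n) (concatMap children xs) ≡ sumOver (paths f (suc n)) xs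
  sumOver-children f n []       = refl
  sumOver-children f n (x ∷ xs) = trans (sym (ℕ.+-assoc (paths f n (num (left x)) (den (left x))) _ _))
    (cong (paths f (suc n) (num x) (den x) ℕ.+_) (sumOver-children f n xs))

  -- Generations move one at a time from the list to `paths`, which is why n is arbitrary: at m = 0
  -- the descent starts from the root, and n = 0 is the count over a generation.
  sumOver-generation : ∀ f m n → sumOver (paths f n) (generation (suc m)) ≡ paths f (m ℕ.+ n) 1 1
  sumOver-generation f zero    n = ℕ.+-identityʳ _
  sumOver-generation f (suc m) n = trans (sumOver-children f n (generation (suc m)))
    (trans (sumOver-generation f m (suc n)) (cong (λ k → paths f k 1 1) (ℕ.+-suc m n)))

  length-filter : ∀ {P : ℚ → Set} (P? : ∀ q → Dec (P q)) f {xs} →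
                  All (λ x → 𝟙 (P? (value x)) ≡ f (num x) (den x)) xs → length (filter P? (map value xs)) ≡ sumOver f xs
  length-filter P? f []                     = refl
  length-filter P? f (_∷_ {x} eq eqs) with P? (value x)
  ... | yes _ = cong₂ ℕ._+_ eq (length-filter P? f eqs)
  ... | no  _ = cong₂ ℕ._+_ eq (length-filter P? f eqs)

  PrimitiveFraction : ℕ → Fraction → Set
  PrimitiveFraction p x = Primitive p (num x) (den x)

  module _ {p} ⦃ pr : Prime p ⦄ where
    private
      instance
        p≢0 : NonZero p
        p≢0 = prime⇒nonZero pr
        p-nonTrivial : ℕ.NonTrivial p
        p-nonTrivial = prime⇒nonTrivial pr

      p≢1 : p ≢ 1
      p≢1 = ℕ.nonTrivial⇒≢1

    generation-primitive : ∀ n → All (PrimitiveFraction p) (generation n)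
    generation-primitive 0             = []
    generation-primitive 1             = (λ (p∣1 , _) → p≢1 (∣1⇒≡1 p∣1)) ∷ []
    generation-primitive (suc (suc n)) = go (generation-primitive (suc n))
      where
      go : ∀ {xs} → All (PrimitiveFraction p) xs → All (PrimitiveFraction p) (concatMap children xs)
      go []                = []
      go {x ∷ _} (h ∷ hs) = left-primitive h ∷ right-primitive {a = num x} h ∷ go hs

    F-suc : ∀ (z : ℚₚ p) ν f →
            (∀ x → PrimitiveFraction p x → 𝟙 (ordₚ ι (value x) -ₚ z ≥? ν) ≡ f (num x) (den x)) →
            ∀ n → F z ν (suc n) ≡ (+ paths f n 1 1 ℚ./ 2 ℕ.^ n) ⦃ ℕ.m^n≢0 2 n ⦄
    F-suc z ν f f≡ n = 2^-[1+n]+1*/1 n count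
      where
      count : length (filter (λ q → ordₚ ι q -ₚ z ≥? ν) (𝒯 (suc n))) ≡ paths f n 1 1
      count = trans
        (length-filter (λ q → ordₚ ι q -ₚ z ≥? ν) f {generation (suc n)}
          (All.map (λ {x} prim → f≡ x prim) (generation-primitive (suc n))))
        (trans (sumOver-generation f n 0) (cong (λ k → paths f k 1 1) (ℕ.+-identityʳ n)))

    -- Beyond the Cauchy threshold for ν, replacing z by a term of its sequence changes q - z by
    -- something of valuation at least ν, which is harmless by the ultrametric inequality.
    ord-approx : ∀ (z : ℚₚ p) ν {N} → proj₁ (cauchy z ν) ℕ.≤ N → ∀ q →
                 (ordₚ (ι q -ₚ z) ≥ ν) ⇔ [ ν ] ≤⁺ ord p (q ℚ.- seq z N)
    ord-approx z ν {N} N₀≤N q = mk⇔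
      (λ (N₁ , h) → let n = N₁ ℕ.⊔ N in
        transfer (N₁≤ N₁) (h n (ℕ.m≤m⊔n N₁ N)))
      (λ h → N , λ n N≤n → ord-transfer p ν (q ℚ.- seq z N) (q ℚ.- seq z n) h
        (close N n N₀≤N (ℕ.≤-trans N₀≤N N≤n)))
      where
      close : ∀ m n → proj₁ (cauchy z ν) ℕ.≤ m → proj₁ (cauchy z ν) ℕ.≤ n →
              [ ν ] ≤⁺ ord p ((q ℚ.- seq z n) ℚ.- (q ℚ.- seq z m))
      close m n N₀≤m N₀≤n = subst (λ x → [ ν ] ≤⁺ ord p x)
        (solve 3 (λ q x y → x :- y := (q :- y) :- (q :- x)) refl q (seq z m) (seq z n))
        (proj₂ (cauchy z ν) m n N₀≤m N₀≤n)
        where open ℚ.+-*-Solver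
      N₁≤ : ∀ N₁ → proj₁ (cauchy z ν) ℕ.≤ N₁ ℕ.⊔ N
      N₁≤ N₁ = ℕ.≤-trans N₀≤N (ℕ.m≤n⊔m N₁ N)
      transfer : ∀ {n} → proj₁ (cauchy z ν) ℕ.≤ n → [ ν ] ≤⁺ ord p (q ℚ.- seq z n) → [ ν ] ≤⁺ ord p (q ℚ.- seq z N)
      transfer {n} N₀≤n h = ord-transfer p ν (q ℚ.- seq z n) (q ℚ.- seq z N) h (close n N N₀≤n N₀≤N)

    projective-points : ℕ → ℕ
    projective-points κ = p ℕ.^ suc κ ℕ.+ p ℕ.^ κ

    projective-points≢0 : ∀ κ → NonZero (projective-points κ)
    projective-points≢0 κ = +-nonZeroʳ (p ℕ.^ suc κ) (p ℕ.^ κ) ⦃ ℕ.m^n≢0 p κ ⦄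

    density : (ℕ → ℕ → ℕ) → ℕ → ℚ
    density f n = (+ paths f n 1 1 ℚ./ 2 ℕ.^ n) ⦃ ℕ.m^n≢0 2 n ⦄

    1/projective-points : ℕ → ℚ
    1/projective-points κ = (+ 1 ℚ./ projective-points κ) ⦃ projective-points≢0 κ ⦄

    density-target : ∀ κ s → density (target pr κ s) ⟶ 1/projective-points κ
    density-target κ s = /2^⟶1/ (λ n → paths (target pr κ s) n 1 1) (projective-points κ)
      ⦃ projective-points≢0 κ ⦄ (equidistribution pr κ s)

    -- The tree is symmetric under exchanging numerator and denominator, and its root is fixed, so
    -- points given by b + s a ≡ 0 have the same share.
    density-flip : ∀ κ s → density (λ a b → target pr κ s b a) ⟶ 1/projective-points κ
    density-flip κ s = ⟶-cong (density-target κ s)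
      (λ n → cong (λ c → (+ c ℚ./ 2 ℕ.^ n) ⦃ ℕ.m^n≢0 2 n ⦄) (paths-flip (target pr κ s) n 1 1))

    LinearForm : ℕ → (u w : ℤ) → Set
    LinearForm κ u w = ∃ λ f →
      (∀ a b → 𝟙 (p ℕ.^ suc κ ∣? ℤ.∣ + a ℤ.* w ℤ.- u ℤ.* + b ∣) ≡ f a b) × density f ⟶ 1/projective-points κ

    linear-form-∤den : ∀ κ u w → ¬ (p ∣ ℤ.∣ w ∣) → LinearForm κ u w
    linear-form-∤den κ u w p∤w = form
      (normal-form w (ℤ.- u) (p ℕ.^ suc κ) ⦃ ℕ.m^n≢0 p (suc κ) ⦄ (∤⇒coprime pr p∤w (suc κ)))
      where
      open ℤ.+-*-Solver
      form≡ : ∀ a b → ℤ.∣ + a ℤ.* w ℤ.- u ℤ.* + b ∣ ≡ ℤ.∣ w ℤ.* + a ℤ.+ ℤ.- u ℤ.* + b ∣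
      form≡ a b = cong ℤ.∣_∣ (solve 4 (λ a w u b → a :* w :- u :* b := w :* a :+ :- u :* b) refl (+ a) w u (+ b))
      form : (∃ λ s → ∀ a b → p ℕ.^ suc κ ∣ ℤ.∣ w ℤ.* + a ℤ.+ ℤ.- u ℤ.* + b ∣ ⇔ p ℕ.^ suc κ ∣ a ℕ.+ s ℕ.* b) → LinearForm κ u w
      form (s , h) = target pr κ s ,
        (λ a b → 𝟙-cong (p ℕ.^ suc κ ∣? ℤ.∣ + a ℤ.* w ℤ.- u ℤ.* + b ∣) (p ℕ.^ suc κ ∣? a ℕ.+ s ℕ.* b)
          (Equivalence.to (h a b) ∘ subst (p ℕ.^ suc κ ∣_) (form≡ a b))
          (subst (p ℕ.^ suc κ ∣_) (sym (form≡ a b)) ∘ Equivalence.from (h a b))) ,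
        density-target κ s

    linear-form-∤num : ∀ κ u w → ¬ (p ∣ ℤ.∣ u ∣) → LinearForm κ u w
    linear-form-∤num κ u w p∤u = form
      (normal-form u (ℤ.- w) (p ℕ.^ suc κ) ⦃ ℕ.m^n≢0 p (suc κ) ⦄ (∤⇒coprime pr p∤u (suc κ)))
      where
      open ℤ.+-*-Solver
      form≡ : ∀ a b → ℤ.∣ + a ℤ.* w ℤ.- u ℤ.* + b ∣ ≡ ℤ.∣ u ℤ.* + b ℤ.+ ℤ.- w ℤ.* + a ∣
      form≡ a b = trans (sym (ℤ.∣-i∣≡∣i∣ (+ a ℤ.* w ℤ.- u ℤ.* + b))) (cong ℤ.∣_∣
        (solve 4 (λ a w u b → :- (a :* w :- u :* b) := u :* b :+ :- w :* a) refl (+ a) w u (+ b)))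
      form : (∃ λ s → ∀ b a → p ℕ.^ suc κ ∣ ℤ.∣ u ℤ.* + b ℤ.+ ℤ.- w ℤ.* + a ∣ ⇔ p ℕ.^ suc κ ∣ b ℕ.+ s ℕ.* a) → LinearForm κ u w
      form (s , h) = (λ a b → target pr κ s b a) ,
        (λ a b → 𝟙-cong (p ℕ.^ suc κ ∣? ℤ.∣ + a ℤ.* w ℤ.- u ℤ.* + b ∣) (p ℕ.^ suc κ ∣? b ℕ.+ s ℕ.* a)
          (Equivalence.to (h b a) ∘ subst (p ℕ.^ suc κ ∣_) (form≡ a b))
          (subst (p ℕ.^ suc κ ∣_) (sym (form≡ a b)) ∘ Equivalence.from (h b a))) ,
        density-flip κ s

    -- Modulo p ^ suc κ the fractions with a w ≡ u b form a single point of the projective line,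
    -- given by an equation a + s b ≡ 0 or b + s a ≡ 0 according to whether w or u is prime to p.
    linear-form : ∀ κ q → LinearForm κ (↥ q) (↧ q)
    linear-form κ q@(mkℚ u w-1 cop) with p ∣? suc w-1
    ... | no p∤w  = linear-form-∤den κ u (+ suc w-1) p∤w
    ... | yes p∣w = linear-form-∤num κ u (+ suc w-1) (λ p∣u → p≢1 (Coprimality.recompute cop (p∣u , p∣w)))

    -- The common core of the first two limits. With ω the valuation of the denominator of the
    -- approximating term, ν = m + 1 - ω turns closeness into divisibility by p ^ (m + 1 + ω),
    -- whence κ = m + ω.
    close-limit : ∀ (z : ℚₚ p) ν {N} → proj₁ (cauchy z ν) ℕ.≤ N → ∀ m →
                  ν ≡ + suc m ℤ.- + ordℕ p (↧ₙ seq z N) →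
                  F z ν ⟶ 1/projective-points (m ℕ.+ ordℕ p (↧ₙ seq z N))
    close-limit z ν {N} N₀≤N m ν≡ = limit (linear-form κ q)
      where
      q : ℚ
      q = seq z N
      κ : ℕ
      κ = m ℕ.+ ordℕ p (↧ₙ q)
      A : Fraction → ℤ
      A x = + num x ℤ.* ↧ q ℤ.- ↥ q ℤ.* + den x
      test : ∀ x → PrimitiveFraction p x → (ordₚ (ι (value x) -ₚ z) ≥ ν) ⇔ p ℕ.^ suc κ ∣ ℤ.∣ A x ∣
      test x prim = mk⇔
        (λ h → Equivalence.to divides⇔ (subst (λ i → [ i ] ≤⁺ ord p (value x ℚ.- q)) ν≡ (Equivalence.to approx h)))
        (λ h → Equivalence.from approx (subst (λ i → [ i ] ≤⁺ ord p (value x ℚ.- q)) (sym ν≡) (Equivalence.from divides⇔ h)))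
        where
        approx = ord-approx z ν N₀≤N (value x)
        divides⇔ = ord-value--≥⇔ (suc m) (num x) (den x) prim q
      limit : LinearForm κ (↥ q) (↧ q) → F z ν ⟶ 1/projective-points κ
      limit (f , f≡ , lim) = ⟶-suc {F z ν} {density f} lim (F-suc z ν f (λ x prim → trans
        (𝟙-cong (ordₚ ι (value x) -ₚ z ≥? ν) (p ℕ.^ suc κ ∣? ℤ.∣ A x ∣)
          (Equivalence.to (test x prim)) (Equivalence.from (test x prim)))
        (f≡ (num x) (den x))))

    1/[^+^]≡1/projective-points : ∀ {i j κ} → i ≡ + suc κ → j ≡ + κ → 1/projective-points κ ≡ 1/[ p ^ i +^ j ]
    1/[^+^]≡1/projective-points {κ = κ} i≡ j≡ = sym (1/[^+^]≡ p i≡ j≡ ⦃ projective-points≢0 κ ⦄)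

    -- If p divided the denominator, a nonnegative valuation would make p divide the numerator as
    -- well, against lowest terms.
    integral⇒ordℕ-den≡0 : ∀ q → [ ℤ.0ℤ ] ≤⁺ ord p q → ordℕ p (↧ₙ q) ≡ 0
    integral⇒ordℕ-den≡0 (mkℚ u w-1 cop) h = ω≡0 (ordℕ p (suc w-1)) refl
      where
      ω≡0 : ∀ ω → ordℕ p (suc w-1) ≡ ω → ordℕ p (suc w-1) ≡ 0
      ω≡0 zero    eq = eq
      ω≡0 (suc k) eq = contradiction (Coprimality.recompute cop (p∣ (≤ordℤ⇒^∣ p (suc k) u ω≤ordu) , p∣ p^∣w)) p≢1
        where
        p∣ : ∀ {n} → p ℕ.^ suc k ∣ n → p ∣ n
        p∣ = ∣-trans (m∣m*n (p ℕ.^ k))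
        p^∣w : p ℕ.^ suc k ∣ suc w-1
        p^∣w = ≤ordℕ⇒^∣ p (suc k) (suc w-1) (ℕ.≤-reflexive (sym eq))
        ω≤ordu : [ + suc k ] ≤⁺ ordℤ p u
        ω≤ordu = ≤-map-+⁻¹ (ℤ.- + suc k) (subst₂ (λ i j → [ i ] ≤⁺ Maybe.map (ℤ._- + j) (ordℤ p u))
          (sym (ℤ.+-inverseʳ (+ suc k))) eq h)

    []-injective : ∀ {i j : ℤ} → [ i ] ≡ [ j ] → i ≡ j
    []-injective refl = refl

    -- The valuation being negative, a numerator divisible by p would force p into the denominator
    -- too. So the numerator has valuation 0, and l comes from the denominator alone.
    negative⇒ordℕ-den : ∀ q {l} → ord p q ≡ [ ℤ.- l ] → ℤ.- l ℤ.< ℤ.0ℤ → + ordℕ p (↧ₙ q) ≡ l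
    negative⇒ordℕ-den (mkℚ u w-1 cop) {l} eq -l<0 = go (ordℤ p u) refl eq
      where
      ω : ℕ
      ω = ordℕ p (suc w-1)
      go : ∀ v → ordℤ p u ≡ v → Maybe.map (ℤ._- + ω) v ≡ [ ℤ.- l ] → + ω ≡ l
      go [ + zero ]    ordu≡ eq = ℤ.neg-injective (trans (sym (ℤ.+-identityˡ (ℤ.- + ω))) ([]-injective eq))
      go [ + suc v ]   ordu≡ eq = contradiction (Coprimality.recompute cop (p∣u , p∣w)) p≢1
        where
        p∣u : p ∣ ℤ.∣ u ∣
        p∣u = subst (_∣ ℤ.∣ u ∣) (ℕ.*-identityʳ p)
          (≤ordℤ⇒^∣ p 1 u (subst ([ + 1 ] ≤⁺_) (sym ordu≡) [ ℤ.+≤+ (ℕ.s≤s ℕ.z≤n) ]))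
        1≤ω : 1 ℕ.≤ ω
        1≤ω = ℕ.n≢0⇒n>0 λ ω≡0 → ℤ.<-asym (subst (ℤ._< ℤ.0ℤ)
          (trans (sym ([]-injective eq)) (trans (cong (λ k → + suc v ℤ.- + k) ω≡0) (ℤ.+-identityʳ (+ suc v)))) -l<0)
          (ℤ.+<+ (ℕ.s≤s ℕ.z≤n))
        p∣w : p ∣ suc w-1
        p∣w = subst (_∣ suc w-1) (ℕ.*-identityʳ p) (≤ordℕ⇒^∣ p 1 (suc w-1) 1≤ω)
      go [ -[1+ v ] ] ordu≡ eq = contradiction
        (subst ([ + 0 ] ≤⁺_) ordu≡ (^∣⇒≤ordℤ p 0 u (1∣ _))) λ { [ () ] }

    limit-integer : ∀ ν z → IsInteger z → ((z ≉ 0ₚ) × (ordₚ z < ν)) ⊎ ((z ≈ 0ₚ) × (ν ℤ.≥ ℤ.1ℤ)) →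
                    F z ν ⟶ 1/[ p ^ ν +^ (ν ℤ.- ℤ.1ℤ) ]
    limit-integer ν z (N₁ , ord≥0) alternatives = at-least-1 ν 1≤ν refl
      where
      1≤ν : ℤ.1ℤ ℤ.≤ ν
      1≤ν = case alternatives of λ where
        (inj₂ (_ , ν≥1)) → ν≥1
        -- If ν ≤ 0, integrality would already give ord z ≥ 0 ≥ ν.
        (inj₁ (_ , z<ν)) → ℤ.i<j⇒suc[i]≤j (ℤ.≰⇒> λ ν≤0 →
          z<ν (N₁ , λ n N₁≤n → ≤⁺-trans ℤ.≤-trans [ ν≤0 ] (ord≥0 n N₁≤n)))
      -- From this index on the terms are integral and approximate z to order ν; so ω = 0 and κ = ν
      -- - 1.
      N : ℕ
      N = N₁ ℕ.⊔ proj₁ (cauchy z ν)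
      ω≡0 : ordℕ p (↧ₙ seq z N) ≡ 0
      ω≡0 = integral⇒ordℕ-den≡0 (seq z N) (ord≥0 N (ℕ.m≤m⊔n N₁ _))
      at-least-1 : ∀ i → ℤ.1ℤ ℤ.≤ i → i ≡ ν → F z ν ⟶ 1/[ p ^ ν +^ (ν ℤ.- ℤ.1ℤ) ]
      at-least-1 (+ zero)  (ℤ.+≤+ ()) _
      at-least-1 -[1+ _ ]  ()         _
      at-least-1 (+ suc m) _          refl = subst (F z ν ⟶_)
        (trans (cong 1/projective-points (trans (cong (m ℕ.+_) ω≡0) (ℕ.+-identityʳ m)))
          (1/[^+^]≡1/projective-points {κ = m} refl refl))
        (close-limit z ν (ℕ.m≤n⊔m N₁ _) m
          (trans (sym (ℤ.+-identityʳ (+ suc m))) (cong (λ k → + suc m ℤ.- + k) (sym ω≡0))))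

    -- Denominators of late terms have valuation ω = l, and ν > - l makes ν + l = m + 1 positive;
    -- hence κ + 1 = m + 1 + ω = ν + 2 l.
    limit-nonInteger : ∀ ν z l → ordₚ z ≡ (ℤ.- l) → ℤ.- l ℤ.< ℤ.0ℤ → ordₚ z < ν →
                       F z ν ⟶ 1/[ p ^ (ν ℤ.+ + 2 ℤ.* l) +^ (ν ℤ.+ + 2 ℤ.* l ℤ.- ℤ.1ℤ) ]
    limit-nonInteger ν z l (N₁ , ord≡) -l<0 z<ν = positive (ν ℤ.+ l) 0<ν+l refl
      where
      open ℤ.+-*-Solver
      N : ℕ
      N = N₁ ℕ.⊔ proj₁ (cauchy z ν)
      ω : ℕ
      ω = ordℕ p (↧ₙ seq z N)
      ω≡l : + ω ≡ l
      ω≡l = negative⇒ordℕ-den (seq z N) (ord≡ N (ℕ.m≤m⊔n N₁ _)) -l<0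
      -l<ν : ℤ.- l ℤ.< ν
      -l<ν = ℤ.≰⇒> λ ν≤-l → z<ν (N₁ , λ n N₁≤n → subst ([ ν ] ≤⁺_) (sym (ord≡ n N₁≤n)) [ ν≤-l ])
      0<ν+l : ℤ.0ℤ ℤ.< ν ℤ.+ l
      0<ν+l = subst (ℤ._< ν ℤ.+ l) (ℤ.+-inverseˡ l) (ℤ.+-monoˡ-< l -l<ν)
      positive : ∀ i → ℤ.0ℤ ℤ.< i → ν ℤ.+ l ≡ i →
                 F z ν ⟶ 1/[ p ^ (ν ℤ.+ + 2 ℤ.* l) +^ (ν ℤ.+ + 2 ℤ.* l ℤ.- ℤ.1ℤ) ]
      positive (+ zero)  (ℤ.+<+ ()) _
      positive -[1+ _ ]  ()         _
      positive (+ suc m) _          ν+l≡ = subst (F z ν ⟶_)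
        (1/[^+^]≡1/projective-points ν+2l≡ (cong (ℤ._- ℤ.1ℤ) ν+2l≡))
        (close-limit z ν (ℕ.m≤n⊔m N₁ _) m
          (trans (solve 2 (λ ν l → ν := (ν :+ l) :- l) refl ν l) (cong₂ ℤ._-_ ν+l≡ (sym ω≡l))))
        where
        ν+2l≡ : ν ℤ.+ + 2 ℤ.* l ≡ + suc (m ℕ.+ ω)
        ν+2l≡ = trans (solve 2 (λ ν l → ν :+ con (+ 2) :* l := (ν :+ l) :+ l) refl ν l) (cong₂ ℤ._+_ ν+l≡ (sym ω≡l))

    limit-zero : ∀ ν z → z ≈ 0ₚ → ℤ.- ν ℤ.≤ ℤ.0ℤ → F z (ℤ.- ν) ⟶ 1ℚ ℚ.- 1/[ p ^ (ν ℤ.+ ℤ.1ℤ) +^ ν ]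
    limit-zero -[1+ _ ] z z≈0 (ℤ.+≤+ ())
    limit-zero (+ n)    z z≈0 _ = subst (λ l → F z -n ⟶ 1ℚ ℚ.- l)
      (1/[^+^]≡1/projective-points (cong +_ (ℕ.+-comm n 1)) refl)
      (⟶-suc {F z -n} {λ k → 1ℚ ℚ.- density g k} (⟶-complement {density g} (density-flip n 0))
        (λ k → trans (F-suc z -n f f≡ k) (/-complement {paths f k 1 1} {paths g k 1 1} (2 ℕ.^ k) ⦃ ℕ.m^n≢0 2 k ⦄ (paths-complement f g f+g≡1 k 1 1))))
      where
      -n : ℤ
      -n = ℤ.- + n
      M N : ℕ
      M = p ℕ.^ suc n
      N = proj₁ (z≈0 -n) ℕ.⊔ proj₁ (cauchy z -n)
      f g : ℕ → ℕ → ℕ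
      f a b = 𝟙 (¬? (M ∣? b))
      -- With s = 0 and swapped arguments the target equation is b ≡ 0 modulo M, the point (1 : 0),
      -- complementary to `f`.
      g a b = target pr n 0 b a
      f+g≡1 : ∀ a b → f a b ℕ.+ g a b ≡ 1
      f+g≡1 a b = trans (cong (λ x → f a b ℕ.+ 𝟙 (M ∣? x)) (ℕ.+-identityʳ b)) (𝟙-¬ (M ∣? b))
      ord-z : [ -n ] ≤⁺ ord p (seq z N)
      ord-z = subst (λ q → [ -n ] ≤⁺ ord p q) (ℚ.+-identityʳ (seq z N)) (proj₂ (z≈0 -n) N (ℕ.m≤m⊔n _ _))
      -- The terms of a sequence representing 0 need not vanish, but late ones have valuation at
      -- least - n, so subtracting one does not affect the condition.
      sub-z : ∀ q → [ -n ] ≤⁺ ord p (q ℚ.- seq z N) ⇔ [ -n ] ≤⁺ ord p q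
      sub-z q = mk⇔
        (λ h → ord-transfer p -n (q ℚ.- seq z N) q h
          (subst (λ x → [ -n ] ≤⁺ ord p x) (solve 2 (λ q z → z := q :- (q :- z)) refl q (seq z N)) ord-z))
        (λ h → ord-transfer p -n q (q ℚ.- seq z N) h
          (subst (λ x → [ -n ] ≤⁺ ord p x) (solve 2 (λ q z → :- z := (q :- z) :- q) refl q (seq z N))
            (subst ([ -n ] ≤⁺_) (sym (ord-neg p (seq z N))) ord-z)))
        where open ℚ.+-*-Solver
      f≡ : ∀ x → PrimitiveFraction p x → 𝟙 (ordₚ ι (value x) -ₚ z ≥? -n) ≡ f (num x) (den x)
      f≡ x prim = 𝟙-cong (ordₚ ι (value x) -ₚ z ≥? -n) (¬? (M ∣? den x))
        (λ h → Equivalence.to divides⇔ (Equivalence.to (sub-z (value x)) (Equivalence.to approx h)))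
        (λ h → Equivalence.from approx (Equivalence.from (sub-z (value x)) (Equivalence.from divides⇔ h)))
        where
        approx = ord-approx z -n (ℕ.m≤n⊔m (proj₁ (z≈0 -n)) _) (value x)
        divides⇔ = ord-value-≥⇔ n (num x) (den x) prim

open import Data.Integer using (ℤ; 0ℤ; 1ℤ; _≤_; _<_; _≥_; -_; _+_; _-_; _*_; +_)
open import Data.Nat using (ℕ)
open import Data.Nat.Primality using (Prime)
open import Data.Product using (_×_; _,_)
open import Data.Rational using (1ℚ) renaming (_-_ to _-ᵠ_)
open import Data.Sum using (_⊎_)
open import Relation.Nullary using (¬_)


theorem4 : (p : ℕ) ⦃ _ : Prime p ⦄ (ν : ℤ) (z : ℚₚ p) →
    (IsInteger z → ((z ≉ 0ₚ) × (ordₚ z < ν)) ⊎ ((z ≈ 0ₚ) × (ν ≥ 1ℤ)) →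
    F z ν ⟶ 1/[ p ^ ν +^ (ν - 1ℤ) ])
    × ((l : ℤ) → ¬ IsInteger z → ordₚ z ≡ (- l) → - l < 0ℤ → ordₚ z < ν →
    F z ν ⟶ 1/[ p ^ (ν + + 2 * l) +^ (ν + + 2 * l - 1ℤ) ])
    × (z ≈ 0ₚ → - ν ≤ 0ℤ →
    F z (- ν) ⟶ 1ℚ -ᵠ 1/[ p ^ (ν + 1ℤ) +^ ν ])
theorem4 p ν z =
  Counting.limit-integer ν z ,
  (λ l _ → Counting.limit-nonInteger ν z l) ,
  Counting.limit-zero ν z
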